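{- Let $R$ be a finite group and let $M$ be a subgroup of $R$ with $|R:M|=2$. There exists a non-identity automorphism $\varphi$ of $R$ with $g^\varphi\in \{g,g^{ -1}\}$ for every $g\in R\setminus M$ if and only if one of the following holds: (1) $M$ is abelian and $R$ is not a generalised dihedral group on $M$; (2) $M$ contains an abelian subgroup $Z$ with $|M:Z|=2$ and there exists $a\in R\setminus M$ with $a^2\ne 1$, $a^2\in Z\cap Z(R)$ and $z^a=z^{ -1}$ for every $z\in Z$; (3) $|M:Z(M)|=4$ and $\gamma_2(M)=\langle a^2\rangle$ for some $a\in R\setminus M$ such that $o(a)=4$, $z^a=z^{ -1}$ for every $z\in Z(M)$, and $o(am)\ne 2$ for some $m\in M\setminus Z(M)$.
   Context: $Z(G)$ denotes the center of a group $G$, $\gamma_2(G)$ its commutator (derived) subgroup, and $o(g)$ the order of an element $g$. A group $D$ is a generalised dihedral group on $A$ if $A$ is an abelian subgroup of index $2$ in $D$ and there exists an involution $\iota\in D\setminus A$ with $a^\iota=a^{ -1}$ for every $a\in A$. -}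

module Defs where

open import Level using (0ℓ)
open import Data.Nat using (ℕ; zero; suc; _*_; _<_)
open import Data.Fin using (Fin)
open import Data.Fin.Subset using (Subset; _∈_; _∉_; _⊆_; ∣_∣; ⊤)
open import Data.Fin.Subset.Properties using (_∈?_)
open import Data.Fin.Properties using (all?; _≟_)
open import Data.Vec using (tabulate)
open import Data.Bool using (Bool)
open import Data.Product using (Σ; ∃; ∃-syntax; _×_; _,_)
open import Data.Sum using (_⊎_)
open import Relation.Nullary using (¬_; Dec; yes; no)
open import Relation.Nullary.Decidable using (⌊_⌋; _×-dec_; _→-dec_)
open import Relation.Binary.PropositionalEquality using (_≡_; _≢_)
open import Algebra.Structures using (IsGroup)
open import Function using (Bijective; _⇔_)

-- A finite group, presented (up to isomorphism) on the carrier Fin n,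
-- with propositional equality as the group equality.
record FinGroup : Set where
  field
    n       : ℕ
    _∙_     : Fin n → Fin n → Fin n
    ε       : Fin n
    _⁻¹     : Fin n → Fin n
    isGroup : IsGroup _≡_ _∙_ ε _⁻¹
  infixl 7 _∙_
  infix 8 _⁻¹

module _ (G : FinGroup) where
  open FinGroup G

  El : Set
  El = Fin n

  conj : El → El → El
  conj x g = (g ⁻¹ ∙ x) ∙ g

  pow : El → ℕ → El
  pow g zero = ε
  pow g (suc k) = pow g k ∙ g

  HasOrder : El → ℕ → Set
  HasOrder g k = 0 < k × pow g k ≡ ε × (∀ j → 0 < j → j < k → pow g j ≢ ε)

  IsSubgroup : Subset n → Set
  IsSubgroup H = ε ∈ H × (∀ x y → x ∈ H → y ∈ H → x ∙ y ∈ H) × (∀ x → x ∈ H → x ⁻¹ ∈ H)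

  IsAbelianSub : Subset n → Set
  IsAbelianSub H = ∀ x y → x ∈ H → y ∈ H → x ∙ y ≡ y ∙ x

  -- |H : K| = k  (for K ≤ H)
  Index : Subset n → Subset n → ℕ → Set
  Index H K k = ∣ H ∣ ≡ k * ∣ K ∣

  Centre : Subset n → Subset n
  Centre H = tabulate λ x →
    ⌊ (x ∈? H) ×-dec all? (λ y → (y ∈? H) →-dec ((x ∙ y) ≟ (y ∙ x))) ⌋

  data InGen (X : El → Set) : El → Set where
    gen : ∀ {x} → X x → InGen X x
    one : InGen X ε
    mul : ∀ {x y} → InGen X x → InGen X y → InGen X (x ∙ y)
    inv : ∀ {x} → InGen X x → InGen X (x ⁻¹)

  comm : El → El → El
  comm x y = ((x ⁻¹ ∙ y ⁻¹) ∙ x) ∙ y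

  Commutators : Subset n → El → Set
  Commutators H g = ∃[ x ] ∃[ y ] (x ∈ H × y ∈ H × g ≡ comm x y)

  GeneralisedDihedralOn : Subset n → Set
  GeneralisedDihedralOn A =
    IsSubgroup A × IsAbelianSub A × Index ⊤ A 2 ×
    ∃[ ι ] (ι ∉ A × ι ≢ ε × ι ∙ ι ≡ ε × (∀ a → a ∈ A → conj a ι ≡ a ⁻¹))

  IsAutomorphism : (El → El) → Set
  IsAutomorphism φ = (∀ x y → φ (x ∙ y) ≡ φ x ∙ φ y) × Bijective _≡_ _≡_ φ

  Cond1 : Subset n → Set
  Cond1 M = IsAbelianSub M × ¬ GeneralisedDihedralOn M

  Cond2 : Subset n → Set
  Cond2 M = ∃[ Z ] (IsSubgroup Z × Z ⊆ M × IsAbelianSub Z × Index M Z 2 ×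
    ∃[ a ] (a ∉ M × a ∙ a ≢ ε × a ∙ a ∈ Z × a ∙ a ∈ Centre ⊤ ×
            (∀ z → z ∈ Z → conj z a ≡ z ⁻¹)))

  Cond3 : Subset n → Set
  Cond3 M = Index M (Centre M) 4 ×
    ∃[ a ] (a ∉ M × (∀ g → InGen (Commutators M) g ⇔ InGen (λ x → x ≡ a ∙ a) g) ×
            HasOrder a 4 × (∀ z → z ∈ Centre M → conj z a ≡ z ⁻¹) ×
            ∃[ m ] (m ∈ M × m ∉ Centre M × ¬ HasOrder (a ∙ m) 2))

{-# OPTIONS --safe #-}
module Submission where

open import Algebra.Bundles using (Group)
import Algebra.Properties.Group as GroupProperties
open import Data.Bool using (Bool; true; false; not; if_then_else_)
open import Data.Bool.Properties using (T-≡)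
import Data.Bool.Properties as Bool
open import Data.Fin using (Fin; zero; suc; combine; remQuot)
open import Data.Fin.Properties using (_≟_; all?; any?; combine-injective; combine-remQuot; injective⇒≤; suc-injective)
open import Data.Fin.Subset using (Subset; _∈_; _∉_; _⊆_; ∣_∣; ⊤)
open import Data.Fin.Subset.Properties using (_∈?_; ∈⊤; drop-there; ⊆-antisym)
open import Data.List using (List; []; _∷_; length; lookup)
open import Data.List.Membership.Propositional.Properties using (∈-lookup)
open import Data.List.Relation.Unary.All as All using (All; []; _∷_)
open import Data.List.Relation.Unary.AllPairs using (AllPairs; []; _∷_)
open import Data.List.Relation.Unary.Any as Any using (Any; here; there)
open import Data.List.Relation.Unary.Any.Properties using (lookup-index)
open import Data.Nat using (ℕ; zero; suc; _*_; _<_; _≤_; z≤n; s≤s; NonZero)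
import Data.Nat.Properties as ℕ
open import Data.Product using (∃-syntax; _×_; _,_; proj₁; proj₂)
open import Data.Sum using (_⊎_; inj₁; inj₂; [_,_])
open import Data.Vec as Vec using (Vec; []; _∷_; here; there)
import Data.Vec.Properties as Vec
open import Function using (_⇔_; mk⇔; Equivalence; Injective; _∘_)
open import Relation.Nullary using (¬_; Dec; yes; no; contradiction)
open import Relation.Nullary.Decidable using (⌊_⌋; toWitness; decidable-stable; ¬?; _×-dec_; _→-dec_)
open import Relation.Binary using (Rel; Symmetric)
import Relation.Binary.PropositionalEquality as ≡
import Relation.Binary.Reflection as Reflection
import Relation.Binary.Reasoning.Setoid as ≈-Reasoning
open import Defs

-- Necessity.  If φ inverts every element outside M then M is abelian.  Otherwise φ fixes some b ∉ M;
-- let K be the group of fixed points in M.  For m ∈ M ∖ K the element bm is inverted, which determines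
-- φ off K; comparing φ (km) and φ (mk) with φ k and φ m shows that K is abelian and that all elements of
-- M ∖ K act on K by conjugation in the same way.  If |M : K| = 2, then Z = K and a = bm, for any
-- m ∈ M ∖ K, give (2).
-- Otherwise two elements of M ∖ K have their product in M ∖ K, so this common action is trivial, K = Z(M), and
-- elements of M ∖ K commute up to b² exactly when their product is not in K, which gives (3) with a = b.
-- Sufficiency.  In each case an explicit automorphism of M is extended to R by choosing the image of a.
-- Each such extension is an involution, since it is one on the complement of M, which generates R.

-- The automorphisms built for sufficiency are the ones that necessity forces. If every element
-- outside `M` is inverted, then `φ m = φ a ⁻¹ ∙ φ (a ∙ m)` reads `a m⁻¹ a⁻¹`, the formula used for
-- (1); if instead `a` is fixed and `am` inverted, it reads `a⁻¹ m⁻¹ a⁻¹`, the formula used for (3).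
-- In (2) the distinguished `a` is itself an inverted element, so its image is `a⁻¹`; the fixed `b`
-- is found among the products of `a` with elements of `M` off `Z`. The requirement that `φ` is not
-- the identity is the source of the remaining clauses: `R` not dihedral, `a² ≠ 1` and `o(am) ≠ 2`
-- each say that some inverted element is not an involution and so is really moved. An index is an
-- equation between cardinalities, so every coset argument is a count: a list of elements in
-- distinct cosets bounds the index from below, a list whose cosets cover the group bounds it from
-- above.

-- Words are compared after free reduction.
module GroupSolver {c ℓ} (G : Group c ℓ) where
  open Group G
  open GroupProperties G using (⁻¹-anti-homo-∙; ⁻¹-involutive; ε⁻¹≈ε)

  infixl 7 _⊕_
  infix 8 ⊝_

  data Expr (k : ℕ) : Set where
    var : Fin k → Expr k
    id  : Expr k
    _⊕_ : Expr k → Expr k → Expr k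
    ⊝_  : Expr k → Expr k

  ⟦_⟧ : ∀ {k} → Expr k → Vec Carrier k → Carrier
  ⟦ var i ⟧ ρ = Vec.lookup ρ i
  ⟦ id ⟧    ρ = ε
  ⟦ e ⊕ f ⟧ ρ = ⟦ e ⟧ ρ ∙ ⟦ f ⟧ ρ
  ⟦ ⊝ e ⟧   ρ = ⟦ e ⟧ ρ ⁻¹

  -- (true , i) stands for the inverse of the i-th variable.
  Letter : ℕ → Set
  Letter k = Bool × Fin k

  sign : Bool → Carrier → Carrier
  sign true  x = x ⁻¹
  sign false x = x

  ⟦_⟧ₗ : ∀ {k} → Letter k → Vec Carrier k → Carrier
  ⟦ b , i ⟧ₗ ρ = sign b (Vec.lookup ρ i)

  ⟦_⟧ʷ : ∀ {k} → List (Letter k) → Vec Carrier k → Carrier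
  ⟦ [] ⟧ʷ    ρ = ε
  ⟦ l ∷ w ⟧ʷ ρ = ⟦ l ⟧ₗ ρ ∙ ⟦ w ⟧ʷ ρ

  push : ∀ {k} → Letter k → List (Letter k) → List (Letter k)
  push l       []              = l ∷ []
  push (b , i) ((b′ , j) ∷ w) with i ≟ j | b Bool.≟ not b′
  ... | yes _ | yes _ = w
  ... | _     | _     = (b , i) ∷ (b′ , j) ∷ w

  -- The flag is a pending inversion and `w` the already reduced word to the right, so one traversal
  -- both flattens and cancels.
  reduce : ∀ {k} → Bool → Expr k → List (Letter k) → List (Letter k)
  reduce b     (var i) w = push (b , i) w
  reduce b     id      w = w
  reduce false (e ⊕ f) w = reduce false e (reduce false f w)
  reduce true  (e ⊕ f) w = reduce true f (reduce true e w)
  reduce b     (⊝ e)   w = reduce (not b) e w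

  open ≈-Reasoning setoid

  sign-cancel : ∀ b x y → y ≈ sign (not b) x ∙ (sign b x ∙ y)
  sign-cancel true  x y = begin
    y               ≈⟨ identityˡ y ⟨
    ε ∙ y           ≈⟨ ∙-congʳ (inverseʳ x) ⟨
    x ∙ x ⁻¹ ∙ y    ≈⟨ assoc _ _ _ ⟩
    x ∙ (x ⁻¹ ∙ y)  ∎
  sign-cancel false x y = begin
    y               ≈⟨ identityˡ y ⟨
    ε ∙ y           ≈⟨ ∙-congʳ (inverseˡ x) ⟨
    x ⁻¹ ∙ x ∙ y    ≈⟨ assoc _ _ _ ⟩
    x ⁻¹ ∙ (x ∙ y)  ∎

  push-correct : ∀ {k} (l : Letter k) w ρ → ⟦ push l w ⟧ʷ ρ ≈ ⟦ l ⟧ₗ ρ ∙ ⟦ w ⟧ʷ ρ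
  push-correct l       []             ρ = refl
  push-correct (b , i) ((b′ , j) ∷ w) ρ with i ≟ j | b Bool.≟ not b′
  ... | yes ≡.refl | yes ≡.refl = sign-cancel b′ (Vec.lookup ρ j) (⟦ w ⟧ʷ ρ)
  ... | yes _      | no _       = refl
  ... | no _       | yes _      = refl
  ... | no _       | no _       = refl

  reduce-correct : ∀ {k} b (e : Expr k) w ρ →
                   ⟦ reduce b e w ⟧ʷ ρ ≈ sign b (⟦ e ⟧ ρ) ∙ ⟦ w ⟧ʷ ρ
  reduce-correct b     (var i) w ρ = push-correct (b , i) w ρ
  reduce-correct true  id      w ρ = begin
    ⟦ w ⟧ʷ ρ          ≈⟨ identityˡ _ ⟨
    ε ∙ ⟦ w ⟧ʷ ρ      ≈⟨ ∙-congʳ ε⁻¹≈ε ⟨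
    ε ⁻¹ ∙ ⟦ w ⟧ʷ ρ   ∎
  reduce-correct false id      w ρ = sym (identityˡ _)
  reduce-correct true  (e ⊕ f) w ρ = begin
    ⟦ reduce true f (reduce true e w) ⟧ʷ ρ       ≈⟨ reduce-correct true f _ ρ ⟩
    ⟦ f ⟧ ρ ⁻¹ ∙ ⟦ reduce true e w ⟧ʷ ρ          ≈⟨ ∙-congˡ (reduce-correct true e w ρ) ⟩
    ⟦ f ⟧ ρ ⁻¹ ∙ (⟦ e ⟧ ρ ⁻¹ ∙ ⟦ w ⟧ʷ ρ)         ≈⟨ assoc _ _ _ ⟨
    ⟦ f ⟧ ρ ⁻¹ ∙ ⟦ e ⟧ ρ ⁻¹ ∙ ⟦ w ⟧ʷ ρ           ≈⟨ ∙-congʳ (⁻¹-anti-homo-∙ _ _) ⟨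
    (⟦ e ⟧ ρ ∙ ⟦ f ⟧ ρ) ⁻¹ ∙ ⟦ w ⟧ʷ ρ            ∎
  reduce-correct false (e ⊕ f) w ρ = begin
    ⟦ reduce false e (reduce false f w) ⟧ʷ ρ     ≈⟨ reduce-correct false e _ ρ ⟩
    ⟦ e ⟧ ρ ∙ ⟦ reduce false f w ⟧ʷ ρ            ≈⟨ ∙-congˡ (reduce-correct false f w ρ) ⟩
    ⟦ e ⟧ ρ ∙ (⟦ f ⟧ ρ ∙ ⟦ w ⟧ʷ ρ)               ≈⟨ assoc _ _ _ ⟨
    ⟦ e ⟧ ρ ∙ ⟦ f ⟧ ρ ∙ ⟦ w ⟧ʷ ρ                 ∎
  reduce-correct true  (⊝ e)   w ρ =
    trans (reduce-correct false e w ρ) (∙-congʳ (sym (⁻¹-involutive _)))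
  reduce-correct false (⊝ e)   w ρ = reduce-correct true e w ρ

  open Reflection setoid var ⟦_⟧ (λ e → ⟦ reduce false e [] ⟧ʷ)
    (λ e ρ → trans (reduce-correct false e [] ρ) (identityʳ _)) public
    using (solve; _⊜_)

open ≡ using (_≡_; _≢_; refl; sym; trans; cong; cong₂; subst; module ≡-Reasoning)

-- `AllPairs` relates an entry only to later ones; symmetry supplies the opposite order.
AllPairs-lookup : ∀ {a ℓ} {A : Set a} {_~_ : Rel A ℓ} → Symmetric _~_ → ∀ {xs} → AllPairs _~_ xs →
                  ∀ {i j} → i ≢ j → lookup xs i ~ lookup xs j
AllPairs-lookup ~-sym (px ∷ pxs) {zero}  {zero}  i≢j = contradiction refl i≢j
AllPairs-lookup ~-sym (px ∷ pxs) {zero}  {suc j} i≢j = All.lookup px (∈-lookup j)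
AllPairs-lookup ~-sym (px ∷ pxs) {suc i} {zero}  i≢j = ~-sym (AllPairs-lookup ~-sym (px ∷ pxs) (i≢j ∘ sym))
AllPairs-lookup ~-sym (px ∷ pxs) {suc i} {suc j} i≢j = AllPairs-lookup ~-sym pxs (i≢j ∘ cong suc)

-- With `position`, an enumeration of `S` by `Fin ∣ S ∣`: inequalities between cardinalities become
-- injections between `Fin` types.
element : ∀ {k} (S : Subset k) → Fin ∣ S ∣ → Fin k
element (true  ∷ S) zero    = zero
element (true  ∷ S) (suc i) = suc (element S i)
element (false ∷ S) i       = suc (element S i)

element-∈ : ∀ {k} (S : Subset k) (i : Fin ∣ S ∣) → element S i ∈ S
element-∈ (true  ∷ S) zero    = here
element-∈ (true  ∷ S) (suc i) = there (element-∈ S i)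
element-∈ (false ∷ S) i       = there (element-∈ S i)

element-injective : ∀ {k} (S : Subset k) → Injective _≡_ _≡_ (element S)
element-injective (true  ∷ S) {zero}  {zero}  _  = refl
element-injective (true  ∷ S) {suc i} {suc j} eq = cong suc (element-injective S (suc-injective eq))
element-injective (false ∷ S)                 eq = element-injective S (suc-injective eq)

position : ∀ {k} {S : Subset k} {x : Fin k} → x ∈ S → Fin ∣ S ∣
position {S = true  ∷ S} {zero}  _   = zero
position {S = true  ∷ S} {suc x} x∈S = suc (position (drop-there x∈S))
position {S = false ∷ S} {suc x} x∈S = position (drop-there x∈S)

element-position : ∀ {k} {S : Subset k} {x : Fin k} (x∈S : x ∈ S) → element S (position x∈S) ≡ x
element-position {S = true  ∷ S} {zero}  _   = refl
element-position {S = true  ∷ S} {suc x} x∈S = cong suc (element-position (drop-there x∈S))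
element-position {S = false ∷ S} {suc x} x∈S = cong suc (element-position (drop-there x∈S))

position-injective : ∀ {k} {S : Subset k} {x y : Fin k} (x∈S : x ∈ S) (y∈S : y ∈ S) →
                     position x∈S ≡ position y∈S → x ≡ y
position-injective {S = S} x∈S y∈S eq =
  trans (sym (element-position x∈S)) (trans (cong (element S) eq) (element-position y∈S))

-- Finite groups: counting cosets, subgroups of index two, centres.

module FiniteGroup (G : FinGroup) where
  open FinGroup G public

  group : Group _ _
  group = record { isGroup = isGroup }

  open GroupSolver group public using (solve; _⊜_; _⊕_; ⊝_; id)
  open ≡-Reasoning public

  module _ {H K : Subset n} (H≤ : IsSubgroup G H) (K≤ : IsSubgroup G K) (K⊆H : K ⊆ H) where

    -- The products `r ∙ k` are pairwise distinct: `r ∙ k ≡ r′ ∙ k′` gives `r ⁻¹ ∙ r′ ≡ k ∙ k′ ⁻¹`,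
    -- which lies in `K`, so `r` and `r′` are the same entry.
    distinct-cosets⇒≤ : (rs : List (Fin n)) → All (_∈ H) rs → AllPairs (λ x y → x ⁻¹ ∙ y ∉ K) rs →
                        length rs * ∣ K ∣ ≤ ∣ H ∣
    distinct-cosets⇒≤ rs rs⊆H distinct = injective⇒≤ {f = λ p → position (∈H (split p))} injective
      where
      value : Fin (length rs) × Fin ∣ K ∣ → Fin n
      value (i , j) = lookup rs i ∙ element K j

      ∈H : ∀ p → value p ∈ H
      ∈H (i , j) = proj₁ (proj₂ H≤) _ _ (All.lookup rs⊆H (∈-lookup i)) (K⊆H (element-∈ K j))

      flip-∉ : Symmetric (λ x y → x ⁻¹ ∙ y ∉ K)
      flip-∉ {x} {y} ∉K y⁻¹x∈K = ∉K (subst (_∈ K)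
        (solve 2 (λ x y → ⊝ (⊝ y ⊕ x) ⊜ ⊝ x ⊕ y) refl x y) (proj₂ (proj₂ K≤) _ y⁻¹x∈K))

      value-injective : ∀ p q → value p ≡ value q → p ≡ q
      value-injective (i , j) (i′ , j′) eq with i ≟ i′
      ... | yes refl = cong (i ,_) (element-injective K (∙-cancelˡ (lookup rs i) _ _ eq))
        where open GroupProperties group using (∙-cancelˡ)
      ... | no  i≢i′ = contradiction
        (subst (_∈ K) eq′ (proj₁ (proj₂ K≤) _ _ (element-∈ K j) (proj₂ (proj₂ K≤) _ (element-∈ K j′))))
        (AllPairs-lookup flip-∉ distinct i≢i′)
        where
        eq′ : element K j ∙ element K j′ ⁻¹ ≡ lookup rs i ⁻¹ ∙ lookup rs i′
        eq′ = begin
          element K j ∙ element K j′ ⁻¹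
            ≡⟨ solve 3 (λ r k l → k ⊕ ⊝ l ⊜ ⊝ r ⊕ (r ⊕ k) ⊕ ⊝ l) refl (lookup rs i) _ _ ⟩
          lookup rs i ⁻¹ ∙ (lookup rs i ∙ element K j) ∙ element K j′ ⁻¹
            ≡⟨ cong (λ x → lookup rs i ⁻¹ ∙ x ∙ element K j′ ⁻¹) eq ⟩
          lookup rs i ⁻¹ ∙ (lookup rs i′ ∙ element K j′) ∙ element K j′ ⁻¹
            ≡⟨ solve 3 (λ r s l → ⊝ r ⊕ (s ⊕ l) ⊕ ⊝ l ⊜ ⊝ r ⊕ s) refl _ _ (element K j′) ⟩
          lookup rs i ⁻¹ ∙ lookup rs i′ ∎

      split : Fin (length rs * ∣ K ∣) → Fin (length rs) × Fin ∣ K ∣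
      split = remQuot ∣ K ∣

      split-injective : ∀ {p q} → split p ≡ split q → p ≡ q
      split-injective {p} {q} eq = begin
        p                                              ≡⟨ combine-remQuot {length rs} ∣ K ∣ p ⟨
        combine (proj₁ (split p)) (proj₂ (split p))    ≡⟨ cong (λ r → combine (proj₁ r) (proj₂ r)) eq ⟩
        combine (proj₁ (split q)) (proj₂ (split q))    ≡⟨ combine-remQuot {length rs} ∣ K ∣ q ⟩
        q                                              ∎

      injective : Injective _≡_ _≡_ (λ p → position (∈H (split p)))
      injective eq = split-injective (value-injective _ _ (position-injective (∈H _) (∈H _) eq))

  -- Each `h` is recovered from the chosen `r` and the element `r ∙ h` of `K`, so these pairs are at
  -- least as many as the elements of `H`.
  cosets-cover⇒≤ : {H K : Subset n} (rs : List (Fin n)) →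
                   (∀ {h} → h ∈ H → Any (λ r → r ∙ h ∈ K) rs) → ∣ H ∣ ≤ length rs * ∣ K ∣
  cosets-cover⇒≤ {H} {K} rs cover = injective⇒≤ {f = f} f-injective
    where
    open GroupProperties group using (∙-cancelˡ)

    translate : (i : Fin ∣ H ∣) → Any (λ r → r ∙ element H i ∈ K) rs
    translate i = cover (element-∈ H i)

    f : Fin ∣ H ∣ → Fin (length rs * ∣ K ∣)
    f i = combine (Any.index (translate i)) (position (lookup-index (translate i)))

    f-injective : Injective _≡_ _≡_ f
    f-injective {i} {j} eq with combine-injective (Any.index (translate i)) _ (Any.index (translate j)) _ eq
    ... | r≡ , p≡ = element-injective H (∙-cancelˡ (Any.lookup (translate i)) _ _ (trans
      (position-injective (lookup-index (translate i)) (lookup-index (translate j)) p≡)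
      (cong (λ r → lookup rs r ∙ element H j) (sym r≡))))

  module Subgroup {H : Subset n} (H≤ : IsSubgroup G H) where

    ε-∈ : ε ∈ H
    ε-∈ = proj₁ H≤

    ∙-∈ : ∀ {x y} → x ∈ H → y ∈ H → x ∙ y ∈ H
    ∙-∈ = proj₁ (proj₂ H≤) _ _

    ⁻¹-∈ : ∀ {x} → x ∈ H → x ⁻¹ ∈ H
    ⁻¹-∈ = proj₂ (proj₂ H≤) _

    ⁻¹-∈⁻ : ∀ {x} → x ⁻¹ ∈ H → x ∈ H
    ⁻¹-∈⁻ {x} x⁻¹∈H = subst (_∈ H) (solve 1 (λ x → ⊝ ⊝ x ⊜ x) refl x) (⁻¹-∈ x⁻¹∈H)

    ∙-cancelˡ-∈ : ∀ {x y} → x ∈ H → x ∙ y ∈ H → y ∈ H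
    ∙-cancelˡ-∈ {x} {y} x∈H xy∈H =
      subst (_∈ H) (solve 2 (λ x y → ⊝ x ⊕ (x ⊕ y) ⊜ y) refl x y) (∙-∈ (⁻¹-∈ x∈H) xy∈H)

    ∙-cancelʳ-∈ : ∀ {x y} → y ∈ H → x ∙ y ∈ H → x ∈ H
    ∙-cancelʳ-∈ {x} {y} y∈H xy∈H =
      subst (_∈ H) (solve 2 (λ x y → x ⊕ y ⊕ ⊝ y ⊜ x) refl x y) (∙-∈ xy∈H (⁻¹-∈ y∈H))

  module _ {H K : Subset n} {k : ℕ} (H≤ : IsSubgroup G H) (K≤ : IsSubgroup G K) (K⊆H : K ⊆ H)
           (|H:K|≡k : Index G H K k) where

    private instance
      ∣K∣-nonZero : NonZero ∣ K ∣
      ∣K∣-nonZero = Fin⇒NonZero (position (proj₁ K≤))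
        where
        Fin⇒NonZero : ∀ {m} → Fin m → NonZero m
        Fin⇒NonZero {suc m} _ = _

    distinct-cosets⇒length≤index : (rs : List (Fin n)) → All (_∈ H) rs →
                                   AllPairs (λ x y → x ⁻¹ ∙ y ∉ K) rs → length rs ≤ k
    distinct-cosets⇒length≤index rs rs⊆H distinct = ℕ.*-cancelʳ-≤ (length rs) k ∣ K ∣
      (subst (length rs * ∣ K ∣ ≤_) |H:K|≡k (distinct-cosets⇒≤ H≤ K≤ K⊆H rs rs⊆H distinct))

    cosets-cover⇒index≤length : (rs : List (Fin n)) →
                                (∀ {h} → h ∈ H → Any (λ r → r ∙ h ∈ K) rs) → k ≤ length rs
    cosets-cover⇒index≤length rs cover = ℕ.*-cancelʳ-≤ k (length rs) ∣ K ∣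
      (subst (_≤ length rs * ∣ K ∣) |H:K|≡k (cosets-cover⇒≤ rs cover))

    -- If `H` were inside `K`, the single representative `ε` would cover it and the index would be
    -- at most one.
    ∃-outside : 1 < k → ∃[ x ] (x ∈ H × x ∉ K)
    ∃-outside 1<k with any? (λ x → (x ∈? H) ×-dec ¬? (x ∈? K))
    ... | yes found = found
    ... | no  none  = contradiction (cosets-cover⇒index≤length (ε ∷ []) cover) (ℕ.<⇒≱ 1<k)
      where
      open Group group using (identityˡ)
      cover : ∀ {h} → h ∈ H → Any (λ r → r ∙ h ∈ K) (ε ∷ [])
      cover {h} h∈H = here (subst (_∈ K) (sym (identityˡ h))
        (decidable-stable (h ∈? K) (λ h∉K → none (h , h∈H , h∉K))))

  -- Otherwise `ε`, `x ⁻¹` and `y` lie in three distinct cosets. The second is `x ⁻¹` because its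
  -- quotient with `y` is then exactly `x ∙ y`.
  index-two⇒∙-∈ : ∀ {H K} → IsSubgroup G H → IsSubgroup G K → K ⊆ H → Index G H K 2 →
                  ∀ {x y} → x ∈ H → y ∈ H → x ∉ K → y ∉ K → x ∙ y ∈ K
  index-two⇒∙-∈ {H} {K} H≤ K≤ K⊆H |H:K|≡2 {x} {y} x∈H y∈H x∉K y∉K =
    decidable-stable (x ∙ y ∈? K) λ xy∉K → contradiction
      (distinct-cosets⇒length≤index {k = 2} H≤ K≤ K⊆H |H:K|≡2 (ε ∷ x ⁻¹ ∷ y ∷ [])
        (H.ε-∈ ∷ H.⁻¹-∈ x∈H ∷ y∈H ∷ [])
        ( ((x∉K ∘ K.⁻¹-∈⁻ ∘ subst (_∈ K) (solve 1 (λ x → ⊝ id ⊕ x ⊜ x) refl (x ⁻¹)))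
          ∷ (y∉K ∘ subst (_∈ K) (solve 1 (λ x → ⊝ id ⊕ x ⊜ x) refl y)) ∷ [])
        ∷ ((xy∉K ∘ subst (_∈ K) (solve 2 (λ x y → ⊝ ⊝ x ⊕ y ⊜ x ⊕ y) refl x y)) ∷ [])
        ∷ [] ∷ []))
      λ { (s≤s (s≤s ())) }
    where
    module H = Subgroup H≤
    module K = Subgroup K≤

  ⊤-isSubgroup : IsSubgroup G ⊤
  ⊤-isSubgroup = ∈⊤ , (λ _ _ _ _ → ∈⊤) , (λ _ _ → ∈⊤)

  -- `Centre` and `Fixed` are both tabulated decision procedures; this lemma and the next trade
  -- membership for the decided property.
  ∈-tabulate⁺ : {P : Fin n → Set} (P? : ∀ x → Dec (P x)) → ∀ {x} → P x → x ∈ Vec.tabulate (λ x → ⌊ P? x ⌋)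
  ∈-tabulate⁺ P? {x} px = Vec.lookup⇒[]= x _ (trans (Vec.lookup∘tabulate _ x) (isYes≡true (P? x)))
    where
    isYes≡true : (d : Dec _) → ⌊ d ⌋ ≡ true
    isYes≡true (yes _)  = refl
    isYes≡true (no ¬px) = contradiction px ¬px

  ∈-tabulate⁻ : {P : Fin n → Set} (P? : ∀ x → Dec (P x)) → ∀ {x} → x ∈ Vec.tabulate (λ x → ⌊ P? x ⌋) → P x
  ∈-tabulate⁻ P? {x} x∈ = toWitness (Equivalence.from T-≡ (trans (sym (Vec.lookup∘tabulate _ x)) (Vec.[]=⇒lookup x∈)))

  module _ {H : Subset n} where

    central? : ∀ x → Dec (x ∈ H × ∀ y → y ∈ H → x ∙ y ≡ y ∙ x)
    central? x = (x ∈? H) ×-dec all? (λ y → (y ∈? H) →-dec ((x ∙ y) ≟ (y ∙ x)))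

    Centre⁺ : ∀ {x} → x ∈ H → (∀ {y} → y ∈ H → x ∙ y ≡ y ∙ x) → x ∈ Centre G H
    Centre⁺ x∈H central = ∈-tabulate⁺ central? (x∈H , λ _ → central)

    Centre⊆ : Centre G H ⊆ H
    Centre⊆ x∈Z = proj₁ (∈-tabulate⁻ central? x∈Z)

    Centre-central : ∀ {x y} → x ∈ Centre G H → y ∈ H → x ∙ y ≡ y ∙ x
    Centre-central x∈Z = proj₂ (∈-tabulate⁻ central? x∈Z) _

  commute-∙ : ∀ {x y z} → x ∙ z ≡ z ∙ x → y ∙ z ≡ z ∙ y → x ∙ y ∙ z ≡ z ∙ (x ∙ y)
  commute-∙ {x} {y} {z} xz≡zx yz≡zy = begin
    x ∙ y ∙ z    ≡⟨ solve 3 (λ x y z → x ⊕ y ⊕ z ⊜ x ⊕ (y ⊕ z)) refl x y z ⟩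
    x ∙ (y ∙ z)  ≡⟨ cong (x ∙_) yz≡zy ⟩
    x ∙ (z ∙ y)  ≡⟨ solve 3 (λ x y z → x ⊕ (z ⊕ y) ⊜ x ⊕ z ⊕ y) refl x y z ⟩
    x ∙ z ∙ y    ≡⟨ cong (_∙ y) xz≡zx ⟩
    z ∙ x ∙ y    ≡⟨ solve 3 (λ x y z → z ⊕ x ⊕ y ⊜ z ⊕ (x ⊕ y)) refl x y z ⟩
    z ∙ (x ∙ y)  ∎

  commute-⁻¹ : ∀ {x z} → x ∙ z ≡ z ∙ x → x ⁻¹ ∙ z ≡ z ∙ x ⁻¹
  commute-⁻¹ {x} {z} xz≡zx = begin
    x ⁻¹ ∙ z                ≡⟨ solve 2 (λ x z → ⊝ x ⊕ z ⊜ ⊝ x ⊕ (z ⊕ x) ⊕ ⊝ x) refl x z ⟩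
    x ⁻¹ ∙ (z ∙ x) ∙ x ⁻¹   ≡⟨ cong (λ u → x ⁻¹ ∙ u ∙ x ⁻¹) xz≡zx ⟨
    x ⁻¹ ∙ (x ∙ z) ∙ x ⁻¹   ≡⟨ solve 2 (λ x z → ⊝ x ⊕ (x ⊕ z) ⊕ ⊝ x ⊜ z ⊕ ⊝ x) refl x z ⟩
    z ∙ x ⁻¹                ∎

  commute-ε : ∀ {z} → ε ∙ z ≡ z ∙ ε
  commute-ε {z} = solve 1 (λ z → id ⊕ z ⊜ z ⊕ id) refl z

  Centre-isSubgroup : ∀ {H} → IsSubgroup G H → IsSubgroup G (Centre G H)
  Centre-isSubgroup H≤ = Centre⁺ ε-∈ (λ _ → commute-ε)
    , (λ x y x∈Z y∈Z → Centre⁺ (∙-∈ (Centre⊆ x∈Z) (Centre⊆ y∈Z))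
        (λ z∈H → commute-∙ (Centre-central x∈Z z∈H) (Centre-central y∈Z z∈H)))
    , (λ x x∈Z → Centre⁺ (⁻¹-∈ (Centre⊆ x∈Z)) (λ z∈H → commute-⁻¹ (Centre-central x∈Z z∈H)))
    where open Subgroup H≤

  piecewise : Subset n → (Fin n → Fin n) → (Fin n → Fin n) → Fin n → Fin n
  piecewise S f g x = if ⌊ x ∈? S ⌋ then f x else g x

  piecewise-∈ : ∀ S f g {x} → x ∈ S → piecewise S f g x ≡ f x
  piecewise-∈ S f g {x} x∈S with x ∈? S
  ... | yes _   = refl
  ... | no  x∉S = contradiction x∈S x∉S

  piecewise-∉ : ∀ S f g {x} → x ∉ S → piecewise S f g x ≡ g x
  piecewise-∉ S f g {x} x∉S with x ∈? S
  ... | yes x∈S = contradiction x∈S x∉S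
  ... | no  _   = refl

-- Index two: extending automorphisms from `M`, and sufficiency of (1).

module IndexTwo (G : FinGroup) {M : Subset (FinGroup.n G)}
                (M≤ : IsSubgroup G M) (|G:M|≡2 : Index G ⊤ M 2) where
  open FiniteGroup G
  open Subgroup M≤

  outside-∙-outside : ∀ {x y} → x ∉ M → y ∉ M → x ∙ y ∈ M
  outside-∙-outside = index-two⇒∙-∈ ⊤-isSubgroup M≤ (λ _ → ∈⊤) |G:M|≡2 ∈⊤ ∈⊤

  ∃∉M : ∃[ a ] a ∉ M
  ∃∉M with ∃-outside {k = 2} ⊤-isSubgroup M≤ (λ _ → ∈⊤) |G:M|≡2 (s≤s (s≤s z≤n))
  ... | a , _ , a∉M = a , a∉M

  outside-∙-inside : ∀ {x y} → x ∉ M → y ∈ M → x ∙ y ∉ M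
  outside-∙-inside x∉M y∈M xy∈M = x∉M (∙-cancelʳ-∈ y∈M xy∈M)

  inside-∙-outside : ∀ {x y} → x ∈ M → y ∉ M → x ∙ y ∉ M
  inside-∙-outside x∈M y∉M xy∈M = y∉M (∙-cancelˡ-∈ x∈M xy∈M)

  outside-⁻¹ : ∀ {x} → x ∉ M → x ⁻¹ ∉ M
  outside-⁻¹ x∉M x⁻¹∈M = x∉M (⁻¹-∈⁻ x⁻¹∈M)

  -- Both `g⁻¹ x` and `g` lie outside `M`, so their product lies inside.
  conj-∈ : ∀ {x g} → x ∈ M → g ∉ M → conj G x g ∈ M
  conj-∈ x∈M g∉M = outside-∙-outside (outside-∙-inside (outside-⁻¹ g∉M) x∈M) g∉M

  FixesOrInverts : (Fin n → Fin n) → Set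
  FixesOrInverts φ = ∀ g → g ∉ M → (φ g ≡ g) ⊎ (φ g ≡ g ⁻¹)

  module Homomorphism {φ : Fin n → Fin n} (φ-∙ : ∀ x y → φ (x ∙ y) ≡ φ x ∙ φ y) where
    open GroupProperties group using (identityʳ-unique; inverseˡ-unique)

    φ-ε : φ ε ≡ ε
    φ-ε = identityʳ-unique (φ ε) (φ ε) (trans (sym (φ-∙ ε ε)) (cong φ (solve 0 (id ⊕ id ⊜ id) refl)))

    φ-⁻¹ : ∀ x → φ (x ⁻¹) ≡ φ x ⁻¹
    φ-⁻¹ x = inverseˡ-unique _ _ (begin
      φ (x ⁻¹) ∙ φ x   ≡⟨ φ-∙ (x ⁻¹) x ⟨
      φ (x ⁻¹ ∙ x)     ≡⟨ cong φ (solve 1 (λ x → ⊝ x ⊕ x ⊜ id) refl x) ⟩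
      φ ε              ≡⟨ φ-ε ⟩
      ε                ∎)

    -- The complement of M generates the group.
    agree-outside⇒agree : {χ : Fin n → Fin n} → (∀ x y → χ (x ∙ y) ≡ χ x ∙ χ y) →
                          (∀ g → g ∉ M → φ g ≡ χ g) → ∀ g → φ g ≡ χ g
    agree-outside⇒agree {χ} χ-∙ agree g with g ∈? M | ∃∉M
    ... | no  g∉M | _       = agree g g∉M
    ... | yes g∈M | a , a∉M = ∙-cancelˡ (φ a) _ _ (begin
      φ a ∙ φ g  ≡⟨ φ-∙ a g ⟨
      φ (a ∙ g)  ≡⟨ agree _ (outside-∙-inside a∉M g∈M) ⟩
      χ (a ∙ g)  ≡⟨ χ-∙ a g ⟩
      χ a ∙ χ g  ≡⟨ cong (_∙ χ g) (agree a a∉M) ⟨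
      φ a ∙ χ g  ∎)
      where open GroupProperties group using (∙-cancelˡ)

  fixesOrInverts⇒involutive : ∀ {φ} → (∀ x y → φ (x ∙ y) ≡ φ x ∙ φ y) → FixesOrInverts φ → ∀ g → φ (φ g) ≡ g
  fixesOrInverts⇒involutive {φ} φ-∙ fi = Homomorphism.agree-outside⇒agree
    (λ x y → trans (cong φ (φ-∙ x y)) (φ-∙ (φ x) (φ y))) {χ = λ g → g} (λ _ _ → refl) twice
    where
    open Homomorphism φ-∙ using (φ-⁻¹)
    twice : ∀ g → g ∉ M → φ (φ g) ≡ g
    twice g g∉M with fi g g∉M
    ... | inj₁ φg≡g   = trans (cong φ φg≡g) φg≡g
    ... | inj₂ φg≡g⁻¹ = begin
      φ (φ g)    ≡⟨ cong φ φg≡g⁻¹ ⟩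
      φ (g ⁻¹)   ≡⟨ φ-⁻¹ g ⟩
      φ g ⁻¹     ≡⟨ cong _⁻¹ φg≡g⁻¹ ⟩
      g ⁻¹ ⁻¹    ≡⟨ solve 1 (λ g → ⊝ ⊝ g ⊜ g) refl g ⟩
      g          ∎

  fixesOrInverts⇒automorphism : ∀ {φ} → (∀ x y → φ (x ∙ y) ≡ φ x ∙ φ y) → FixesOrInverts φ → IsAutomorphism G φ
  fixesOrInverts⇒automorphism {φ} φ-∙ fi = φ-∙
    , (λ {x} {y} φx≡φy → trans (sym (involutive x)) (trans (cong φ φx≡φy) (involutive y)))
    , (λ y → φ y , λ { refl → involutive y })
    where involutive = fixesOrInverts⇒involutive φ-∙ fi

  -- The left-hand side of the equivalence.
  HasTwist : Set
  HasTwist = ∃[ φ ] (IsAutomorphism G φ × (∃[ g ] φ g ≢ g) × FixesOrInverts φ)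

  -- `R` arises from `M` by adjoining `a` with prescribed `a²` and prescribed conjugation on `M`.
  -- Sending `a` to `c` respects these two relations exactly when `c²≡ψa²` and `ψ-conj` hold.
  module Extension {a c : Fin n} {ψ : Fin n → Fin n} (a∉M : a ∉ M)
                   (ψ-∙ : ∀ {x y} → x ∈ M → y ∈ M → ψ (x ∙ y) ≡ ψ x ∙ ψ y)
                   (c²≡ψa² : c ∙ c ≡ ψ (a ∙ a))
                   (ψ-conj : ∀ {m} → m ∈ M → ψ m ∙ c ≡ c ∙ ψ (conj G m a)) where

    φ : Fin n → Fin n
    φ = piecewise M ψ (λ g → c ∙ ψ (a ⁻¹ ∙ g))

    φ-inside : ∀ {g} → g ∈ M → φ g ≡ ψ g
    φ-inside = piecewise-∈ M ψ (λ g → c ∙ ψ (a ⁻¹ ∙ g))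

    φ-outside : ∀ {g} → g ∉ M → φ g ≡ c ∙ ψ (a ⁻¹ ∙ g)
    φ-outside = piecewise-∉ M ψ (λ g → c ∙ ψ (a ⁻¹ ∙ g))

    φ-∙ : ∀ x y → φ (x ∙ y) ≡ φ x ∙ φ y
    φ-∙ x y = split (x ∈? M) (y ∈? M)
      where
      open Group group using (assoc)
      split : Dec (x ∈ M) → Dec (y ∈ M) → φ (x ∙ y) ≡ φ x ∙ φ y
      split (yes x∈M) (yes y∈M) = begin
        φ (x ∙ y)   ≡⟨ φ-inside (∙-∈ x∈M y∈M) ⟩
        ψ (x ∙ y)   ≡⟨ ψ-∙ x∈M y∈M ⟩
        ψ x ∙ ψ y   ≡⟨ cong₂ _∙_ (φ-inside x∈M) (φ-inside y∈M) ⟨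
        φ x ∙ φ y   ∎
      split (yes x∈M) (no y∉M) = begin
        φ (x ∙ y)                                ≡⟨ φ-outside (inside-∙-outside x∈M y∉M) ⟩
        c ∙ ψ (a ⁻¹ ∙ (x ∙ y))
          ≡⟨ cong (λ u → c ∙ ψ u) (solve 3 (λ a x y → ⊝ a ⊕ (x ⊕ y) ⊜ ⊝ a ⊕ x ⊕ a ⊕ (⊝ a ⊕ y)) refl a x y) ⟩
        c ∙ ψ (conj G x a ∙ (a ⁻¹ ∙ y))
          ≡⟨ cong (c ∙_) (ψ-∙ (conj-∈ x∈M a∉M) (outside-∙-outside (outside-⁻¹ a∉M) y∉M)) ⟩
        c ∙ (ψ (conj G x a) ∙ ψ (a ⁻¹ ∙ y))      ≡⟨ assoc _ _ _ ⟨
        c ∙ ψ (conj G x a) ∙ ψ (a ⁻¹ ∙ y)        ≡⟨ cong (_∙ ψ (a ⁻¹ ∙ y)) (ψ-conj x∈M) ⟨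
        ψ x ∙ c ∙ ψ (a ⁻¹ ∙ y)                   ≡⟨ assoc _ _ _ ⟩
        ψ x ∙ (c ∙ ψ (a ⁻¹ ∙ y))                 ≡⟨ cong₂ _∙_ (φ-inside x∈M) (φ-outside y∉M) ⟨
        φ x ∙ φ y                                ∎
      split (no x∉M) (yes y∈M) = begin
        φ (x ∙ y)                    ≡⟨ φ-outside (outside-∙-inside x∉M y∈M) ⟩
        c ∙ ψ (a ⁻¹ ∙ (x ∙ y))       ≡⟨ cong (λ u → c ∙ ψ u) (assoc _ _ _) ⟨
        c ∙ ψ (a ⁻¹ ∙ x ∙ y)         ≡⟨ cong (c ∙_) (ψ-∙ (outside-∙-outside (outside-⁻¹ a∉M) x∉M) y∈M) ⟩
        c ∙ (ψ (a ⁻¹ ∙ x) ∙ ψ y)     ≡⟨ assoc _ _ _ ⟨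
        c ∙ ψ (a ⁻¹ ∙ x) ∙ ψ y       ≡⟨ cong₂ _∙_ (φ-outside x∉M) (φ-inside y∈M) ⟨
        φ x ∙ φ y                    ∎
      split (no x∉M) (no y∉M) = begin
        φ (x ∙ y)                                               ≡⟨ φ-inside (outside-∙-outside x∉M y∉M) ⟩
        ψ (x ∙ y)
          -- Writing `x = a u` and `y = a v` gives `x y = a² uᵃ v`, a product of elements of `M` to
          -- which `ψ` can be applied factor by factor.
          ≡⟨ cong ψ (solve 3 (λ a x y → x ⊕ y ⊜ a ⊕ a ⊕ (⊝ a ⊕ (⊝ a ⊕ x) ⊕ a ⊕ (⊝ a ⊕ y))) refl a x y) ⟩
        ψ (a ∙ a ∙ (conj G (a ⁻¹ ∙ x) a ∙ (a ⁻¹ ∙ y)))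
          ≡⟨ ψ-∙ (outside-∙-outside a∉M a∉M) (∙-∈ (conj-∈ x∈aM a∉M) y∈aM) ⟩
        ψ (a ∙ a) ∙ ψ (conj G (a ⁻¹ ∙ x) a ∙ (a ⁻¹ ∙ y))
          ≡⟨ cong₂ _∙_ (sym c²≡ψa²) (ψ-∙ (conj-∈ x∈aM a∉M) y∈aM) ⟩
        c ∙ c ∙ (ψ (conj G (a ⁻¹ ∙ x) a) ∙ ψ (a ⁻¹ ∙ y))
          ≡⟨ solve 3 (λ c u v → c ⊕ c ⊕ (u ⊕ v) ⊜ c ⊕ (c ⊕ u) ⊕ v) refl _ _ _ ⟩
        c ∙ (c ∙ ψ (conj G (a ⁻¹ ∙ x) a)) ∙ ψ (a ⁻¹ ∙ y)
          ≡⟨ cong (λ u → c ∙ u ∙ ψ (a ⁻¹ ∙ y)) (ψ-conj x∈aM) ⟨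
        c ∙ (ψ (a ⁻¹ ∙ x) ∙ c) ∙ ψ (a ⁻¹ ∙ y)
          ≡⟨ solve 3 (λ c u v → c ⊕ (u ⊕ c) ⊕ v ⊜ (c ⊕ u) ⊕ (c ⊕ v)) refl _ _ _ ⟩
        (c ∙ ψ (a ⁻¹ ∙ x)) ∙ (c ∙ ψ (a ⁻¹ ∙ y))                 ≡⟨ cong₂ _∙_ (φ-outside x∉M) (φ-outside y∉M) ⟨
        φ x ∙ φ y                                               ∎
        where
        x∈aM = outside-∙-outside (outside-⁻¹ a∉M) x∉M
        y∈aM = outside-∙-outside (outside-⁻¹ a∉M) y∉M

    twist : (∀ {g} → g ∉ M → (c ∙ ψ (a ⁻¹ ∙ g) ≡ g) ⊎ (c ∙ ψ (a ⁻¹ ∙ g) ≡ g ⁻¹)) →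
            ∃[ g ] (g ∉ M × c ∙ ψ (a ⁻¹ ∙ g) ≢ g) → HasTwist
    twist off (g , g∉M , moved) =
      φ , fixesOrInverts⇒automorphism φ-∙ fi
        , (g , λ φg≡g → moved (trans (sym (φ-outside g∉M)) φg≡g)) , fi
      where
      fi : FixesOrInverts φ
      fi g g∉M = subst (λ u → (u ≡ g) ⊎ (u ≡ g ⁻¹)) (sym (φ-outside g∉M)) (off g∉M)

  -- Here `φ` inverts everything outside `M`; the resulting formula on `M` is multiplicative because
  -- `M` is abelian. It moves any outside element that is not an involution, and one exists because
  -- `R` is not dihedral.
  abelian-nonDihedral⇒twist : Cond1 G M → HasTwist
  abelian-nonDihedral⇒twist (abelian , nonDihedral) = Extension.twist {a} {a ⁻¹} {λ m → a ∙ m ⁻¹ ∙ a ⁻¹} a∉M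
    (λ {x} {y} x∈M y∈M → begin
      a ∙ (x ∙ y) ⁻¹ ∙ a ⁻¹               ≡⟨ cong (λ u → a ∙ u ⁻¹ ∙ a ⁻¹) (abelian x y x∈M y∈M) ⟩
      a ∙ (y ∙ x) ⁻¹ ∙ a ⁻¹
        ≡⟨ solve 3 (λ a x y → a ⊕ ⊝ (y ⊕ x) ⊕ ⊝ a ⊜ (a ⊕ ⊝ x ⊕ ⊝ a) ⊕ (a ⊕ ⊝ y ⊕ ⊝ a)) refl a x y ⟩
      a ∙ x ⁻¹ ∙ a ⁻¹ ∙ (a ∙ y ⁻¹ ∙ a ⁻¹) ∎)
    (solve 1 (λ a → ⊝ a ⊕ ⊝ a ⊜ a ⊕ ⊝ (a ⊕ a) ⊕ ⊝ a) refl a)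
    (λ {m} m∈M → begin
      a ∙ m ⁻¹ ∙ a ⁻¹ ∙ a ⁻¹
        ≡⟨ solve 2 (λ a m → a ⊕ ⊝ m ⊕ ⊝ a ⊕ ⊝ a ⊜ ⊝ a ⊕ (a ⊕ a ⊕ ⊝ m) ⊕ ⊝ a ⊕ ⊝ a) refl a m ⟩
      a ⁻¹ ∙ (a ∙ a ∙ m ⁻¹) ∙ a ⁻¹ ∙ a ⁻¹
        -- `a²` lies in the abelian group `M`, so it commutes with `m⁻¹`.
        ≡⟨ cong (λ u → a ⁻¹ ∙ u ∙ a ⁻¹ ∙ a ⁻¹) (abelian _ _ (outside-∙-outside a∉M a∉M) (⁻¹-∈ m∈M)) ⟩
      a ⁻¹ ∙ (m ⁻¹ ∙ (a ∙ a)) ∙ a ⁻¹ ∙ a ⁻¹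
        ≡⟨ solve 2 (λ a m → ⊝ a ⊕ (⊝ m ⊕ (a ⊕ a)) ⊕ ⊝ a ⊕ ⊝ a ⊜ ⊝ a ⊕ (a ⊕ ⊝ (⊝ a ⊕ m ⊕ a) ⊕ ⊝ a)) refl a m ⟩
      a ⁻¹ ∙ (a ∙ conj G m a ⁻¹ ∙ a ⁻¹) ∎)
    (λ {g} _ → inj₂ (inverts g))
    (proj₁ nonInvolution , proj₁ (proj₂ nonInvolution) , λ fixed → proj₂ (proj₂ nonInvolution) (begin
      proj₁ nonInvolution ∙ proj₁ nonInvolution     ≡⟨ cong (_∙ proj₁ nonInvolution) (trans (sym fixed) (inverts _)) ⟩
      proj₁ nonInvolution ⁻¹ ∙ proj₁ nonInvolution  ≡⟨ solve 1 (λ g → ⊝ g ⊕ g ⊜ id) refl _ ⟩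
      ε                                             ∎))
    where
    a = proj₁ ∃∉M
    a∉M = proj₂ ∃∉M

    inverts : ∀ g → a ⁻¹ ∙ (a ∙ (a ⁻¹ ∙ g) ⁻¹ ∙ a ⁻¹) ≡ g ⁻¹
    inverts = solve 2 (λ a g → ⊝ a ⊕ (a ⊕ ⊝ (⊝ a ⊕ g) ⊕ ⊝ a) ⊜ ⊝ g) refl a

    -- From `a² = 1` and `(m a)² = 1` one reads off that `a` inverts `m`.
    involutions⇒dihedral : (∀ g → g ∉ M → g ∙ g ≡ ε) → GeneralisedDihedralOn G M
    involutions⇒dihedral involution = M≤ , abelian , |G:M|≡2 , a , a∉M , (λ a≡ε → a∉M (subst (_∈ M) (sym a≡ε) ε-∈))
      , involution a a∉M , λ m m∈M → begin
        a ⁻¹ ∙ m ∙ a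
          ≡⟨ solve 2 (λ a m → ⊝ a ⊕ m ⊕ a ⊜ ⊝ (a ⊕ a) ⊕ ⊝ m ⊕ (m ⊕ a ⊕ (m ⊕ a))) refl a m ⟩
        (a ∙ a) ⁻¹ ∙ m ⁻¹ ∙ (m ∙ a ∙ (m ∙ a))
          ≡⟨ cong₂ (λ u v → u ⁻¹ ∙ m ⁻¹ ∙ v) (involution a a∉M) (involution _ (inside-∙-outside m∈M a∉M)) ⟩
        ε ⁻¹ ∙ m ⁻¹ ∙ ε
          ≡⟨ solve 1 (λ m → ⊝ id ⊕ ⊝ m ⊕ id ⊜ ⊝ m) refl m ⟩
        m ⁻¹ ∎

    nonInvolution : ∃[ g ] (g ∉ M × g ∙ g ≢ ε)
    nonInvolution with any? (λ g → ¬? (g ∈? M) ×-dec ¬? (g ∙ g ≟ ε))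
    ... | yes found = found
    ... | no  none  = contradiction
      (involutions⇒dihedral λ g g∉M → decidable-stable (g ∙ g ≟ ε) (λ g²≢ε → none (g , g∉M , g²≢ε)))
      nonDihedral

-- Sufficiency of (2) and (3).

module Sufficiency (G : FinGroup) {M : Subset (FinGroup.n G)}
                   (M≤ : IsSubgroup G M) (|G:M|≡2 : Index G ⊤ M 2) where
  open FiniteGroup G
  open Subgroup M≤
  open IndexTwo G M≤ |G:M|≡2
  open Group group using (assoc; identityˡ; identityʳ; inverseˡ)
  open GroupProperties group using (∙-cancelˡ)

  module Inverted {Z : Subset n} {a : Fin n} (Z≤ : IsSubgroup G Z)
                  (inverted : ∀ z → z ∈ Z → conj G z a ≡ z ⁻¹) where
    private
      module Z = Subgroup Z≤

    conj-∈-Z : ∀ {x} → x ∈ Z → conj G x a ∈ Z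
    conj-∈-Z x∈Z = subst (_∈ Z) (sym (inverted _ x∈Z)) (Z.⁻¹-∈ x∈Z)

    -- If `y = xᵃ` were in `Z`, then `yᵃ = y⁻¹`, and undoing the conjugation gives `x = y⁻¹`, again
    -- in `Z`. So conjugation by `a` respects the two branches of a `ψ` defined piecewise along `Z`.
    conj-∉-Z : ∀ {x} → x ∉ Z → conj G x a ∉ Z
    conj-∉-Z {x} x∉Z y∈Z = x∉Z (subst (_∈ Z) y⁻¹≡x (Z.⁻¹-∈ y∈Z))
      where
      y = conj G x a
      y⁻¹≡x : y ⁻¹ ≡ x
      y⁻¹≡x = begin
        y ⁻¹                       ≡⟨ solve 2 (λ a y → ⊝ y ⊜ a ⊕ ⊝ (⊝ a ⊕ y ⊕ a) ⊕ ⊝ a) refl a y ⟩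
        a ∙ conj G y a ⁻¹ ∙ a ⁻¹   ≡⟨ cong (λ u → a ∙ u ⁻¹ ∙ a ⁻¹) (inverted y y∈Z) ⟩
        a ∙ y ⁻¹ ⁻¹ ∙ a ⁻¹         ≡⟨ solve 2 (λ a x → a ⊕ ⊝ ⊝ (⊝ a ⊕ x ⊕ a) ⊕ ⊝ a ⊜ x) refl a x ⟩
        x                          ∎

  -- φ multiplies by a² off the index-two subgroup Z ∪ a(M ∖ Z) of G.
  centralInvolution⇒twist : Cond2 G M → HasTwist
  centralInvolution⇒twist (Z , Z≤ , Z⊆M , _ , |M:Z|≡2 , a , a∉M , a²≢ε , a²∈Z , a²-central , inverted) =
    Extension.twist {a} {a ⁻¹} {ψ} a∉M ψ-∙
      (begin
        a ⁻¹ ∙ a ⁻¹     ≡⟨ solve 1 (λ a → ⊝ a ⊕ ⊝ a ⊜ ⊝ (a ⊕ a)) refl a ⟩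
        t ⁻¹            ≡⟨ t⁻¹≡t ⟩
        t               ≡⟨ ψ-∈ a²∈Z ⟨
        ψ t             ∎)
      ψ-conj off (a , a∉M , moves-a)
    where
    module Z = Subgroup Z≤
    t = a ∙ a

    -- As an element of `Z`, `t` is inverted by `a`; as a power of `a`, it is fixed.
    t⁻¹≡t : t ⁻¹ ≡ t
    t⁻¹≡t = trans (sym (inverted t a²∈Z)) (solve 1 (λ a → ⊝ a ⊕ (a ⊕ a) ⊕ a ⊜ a ⊕ a) refl a)

    t∙ : ∀ x → t ∙ x ≡ x ∙ t
    t∙ x = Centre-central a²-central ∈⊤

    ψ : Fin n → Fin n
    ψ = piecewise Z (λ x → x) (_∙ t)

    ψ-∈ : ∀ {x} → x ∈ Z → ψ x ≡ x
    ψ-∈ = piecewise-∈ Z (λ x → x) (_∙ t)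

    ψ-∉ : ∀ {x} → x ∉ Z → ψ x ≡ x ∙ t
    ψ-∉ = piecewise-∉ Z (λ x → x) (_∙ t)

    ψ-∙ : ∀ {x y} → x ∈ M → y ∈ M → ψ (x ∙ y) ≡ ψ x ∙ ψ y
    ψ-∙ {x} {y} x∈M y∈M = split (x ∈? Z) (y ∈? Z)
      where
      split : Dec (x ∈ Z) → Dec (y ∈ Z) → ψ (x ∙ y) ≡ ψ x ∙ ψ y
      split (yes x∈Z) (yes y∈Z) = trans (ψ-∈ (Z.∙-∈ x∈Z y∈Z)) (sym (cong₂ _∙_ (ψ-∈ x∈Z) (ψ-∈ y∈Z)))
      split (yes x∈Z) (no y∉Z) = begin
        ψ (x ∙ y)    ≡⟨ ψ-∉ (y∉Z ∘ Z.∙-cancelˡ-∈ x∈Z) ⟩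
        x ∙ y ∙ t    ≡⟨ assoc x y t ⟩
        x ∙ (y ∙ t)  ≡⟨ cong₂ _∙_ (ψ-∈ x∈Z) (ψ-∉ y∉Z) ⟨
        ψ x ∙ ψ y    ∎
      split (no x∉Z) (yes y∈Z) = begin
        ψ (x ∙ y)    ≡⟨ ψ-∉ (x∉Z ∘ Z.∙-cancelʳ-∈ y∈Z) ⟩
        x ∙ y ∙ t    ≡⟨ assoc x y t ⟩
        x ∙ (y ∙ t)  ≡⟨ cong (x ∙_) (t∙ y) ⟨
        x ∙ (t ∙ y)  ≡⟨ assoc x t y ⟨
        x ∙ t ∙ y    ≡⟨ cong₂ _∙_ (ψ-∉ x∉Z) (ψ-∈ y∈Z) ⟨
        ψ x ∙ ψ y    ∎
      split (no x∉Z) (no y∉Z) = begin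
        ψ (x ∙ y)          ≡⟨ ψ-∈ (index-two⇒∙-∈ M≤ Z≤ Z⊆M |M:Z|≡2 x∈M y∈M x∉Z y∉Z) ⟩
        x ∙ y              ≡⟨ solve 3 (λ x y t → x ⊕ y ⊜ x ⊕ (y ⊕ t) ⊕ ⊝ t) refl x y t ⟩
        -- `t` is a central involution, so the two extra factors `t` cancel.
        x ∙ (y ∙ t) ∙ t ⁻¹ ≡⟨ cong₂ (λ u v → x ∙ u ∙ v) (sym (t∙ y)) t⁻¹≡t ⟩
        x ∙ (t ∙ y) ∙ t    ≡⟨ solve 3 (λ x y t → x ⊕ (t ⊕ y) ⊕ t ⊜ (x ⊕ t) ⊕ (y ⊕ t)) refl x y t ⟩
        x ∙ t ∙ (y ∙ t)    ≡⟨ cong₂ _∙_ (ψ-∉ x∉Z) (ψ-∉ y∉Z) ⟨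
        ψ x ∙ ψ y          ∎

    open Inverted Z≤ inverted

    -- `a` and `a⁻¹` induce the same conjugation, since they differ by the central `a²`.
    ∙a⁻¹ : ∀ m → m ∙ a ⁻¹ ≡ a ⁻¹ ∙ conj G m a
    ∙a⁻¹ m = begin
      m ∙ a ⁻¹                   ≡⟨ solve 2 (λ a m → m ⊕ ⊝ a ⊜ ⊝ (a ⊕ a) ⊕ (a ⊕ a ⊕ m) ⊕ ⊝ a) refl a m ⟩
      t ⁻¹ ∙ (t ∙ m) ∙ a ⁻¹      ≡⟨ cong (λ u → t ⁻¹ ∙ u ∙ a ⁻¹) (t∙ m) ⟩
      t ⁻¹ ∙ (m ∙ t) ∙ a ⁻¹
        ≡⟨ solve 2 (λ a m → ⊝ (a ⊕ a) ⊕ (m ⊕ (a ⊕ a)) ⊕ ⊝ a ⊜ ⊝ a ⊕ (⊝ a ⊕ m ⊕ a)) refl a m ⟩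
      a ⁻¹ ∙ conj G m a          ∎

    ψ-conj : ∀ {m} → m ∈ M → ψ m ∙ a ⁻¹ ≡ a ⁻¹ ∙ ψ (conj G m a)
    ψ-conj {m} _ = split (m ∈? Z)
      where
      split : Dec (m ∈ Z) → ψ m ∙ a ⁻¹ ≡ a ⁻¹ ∙ ψ (conj G m a)
      split (yes m∈Z) = begin
        ψ m ∙ a ⁻¹                ≡⟨ cong (_∙ a ⁻¹) (ψ-∈ m∈Z) ⟩
        m ∙ a ⁻¹                  ≡⟨ ∙a⁻¹ m ⟩
        a ⁻¹ ∙ conj G m a         ≡⟨ cong (a ⁻¹ ∙_) (ψ-∈ (conj-∈-Z m∈Z)) ⟨
        a ⁻¹ ∙ ψ (conj G m a)     ∎
      split (no m∉Z) = begin
        ψ m ∙ a ⁻¹                ≡⟨ cong (_∙ a ⁻¹) (ψ-∉ m∉Z) ⟩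
        m ∙ t ∙ a ⁻¹              ≡⟨ solve 2 (λ a m → m ⊕ (a ⊕ a) ⊕ ⊝ a ⊜ m ⊕ ⊝ a ⊕ (a ⊕ a)) refl a m ⟩
        m ∙ a ⁻¹ ∙ t              ≡⟨ cong (_∙ t) (∙a⁻¹ m) ⟩
        a ⁻¹ ∙ conj G m a ∙ t     ≡⟨ assoc _ _ _ ⟩
        a ⁻¹ ∙ (conj G m a ∙ t)   ≡⟨ cong (a ⁻¹ ∙_) (ψ-∉ (conj-∉-Z m∉Z)) ⟨
        a ⁻¹ ∙ ψ (conj G m a)     ∎

    -- Write `g = a u`. If `u` is in `Z`, it is inverted by `a`, so `a⁻¹ u = u⁻¹ a⁻¹ = g⁻¹`.
    -- Otherwise the factor `t` from `ψ` makes up for replacing `a` by `a⁻¹`.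
    off : ∀ {g} → g ∉ M → (a ⁻¹ ∙ ψ (a ⁻¹ ∙ g) ≡ g) ⊎ (a ⁻¹ ∙ ψ (a ⁻¹ ∙ g) ≡ g ⁻¹)
    off {g} _ = split (a ⁻¹ ∙ g ∈? Z)
      where
      split : Dec (a ⁻¹ ∙ g ∈ Z) → (a ⁻¹ ∙ ψ (a ⁻¹ ∙ g) ≡ g) ⊎ (a ⁻¹ ∙ ψ (a ⁻¹ ∙ g) ≡ g ⁻¹)
      split (yes ∈Z) = inj₂ (begin
        a ⁻¹ ∙ ψ (a ⁻¹ ∙ g)              ≡⟨ cong (a ⁻¹ ∙_) (ψ-∈ ∈Z) ⟩
        a ⁻¹ ∙ (a ⁻¹ ∙ g)
          ≡⟨ solve 2 (λ a g → ⊝ a ⊕ (⊝ a ⊕ g) ⊜ (⊝ a ⊕ (⊝ a ⊕ g) ⊕ a) ⊕ ⊝ a) refl a g ⟩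
        conj G (a ⁻¹ ∙ g) a ∙ a ⁻¹       ≡⟨ cong (_∙ a ⁻¹) (inverted _ ∈Z) ⟩
        (a ⁻¹ ∙ g) ⁻¹ ∙ a ⁻¹             ≡⟨ solve 2 (λ a g → ⊝ (⊝ a ⊕ g) ⊕ ⊝ a ⊜ ⊝ g) refl a g ⟩
        g ⁻¹                             ∎)
      split (no ∉Z) = inj₁ (begin
        a ⁻¹ ∙ ψ (a ⁻¹ ∙ g)              ≡⟨ cong (a ⁻¹ ∙_) (ψ-∉ ∉Z) ⟩
        a ⁻¹ ∙ (a ⁻¹ ∙ g ∙ t)
          ≡⟨ solve 3 (λ a g t → ⊝ a ⊕ (⊝ a ⊕ g ⊕ t) ⊜ ⊝ (a ⊕ a) ⊕ (g ⊕ t)) refl a g t ⟩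
        t ⁻¹ ∙ (g ∙ t)                   ≡⟨ cong (t ⁻¹ ∙_) (t∙ g) ⟨
        t ⁻¹ ∙ (t ∙ g)                   ≡⟨ solve 2 (λ t g → ⊝ t ⊕ (t ⊕ g) ⊜ g) refl t g ⟩
        g                                ∎)

    moves-a : a ⁻¹ ∙ ψ (a ⁻¹ ∙ a) ≢ a
    moves-a fixed = a²≢ε (begin
      a ∙ a                          ≡⟨ cong (_∙ a) fixed ⟨
      a ⁻¹ ∙ ψ (a ⁻¹ ∙ a) ∙ a        ≡⟨ cong (λ u → a ⁻¹ ∙ u ∙ a) (ψ-∈ (subst (_∈ Z) (sym (inverseˡ a)) Z.ε-∈)) ⟩
      a ⁻¹ ∙ (a ⁻¹ ∙ a) ∙ a          ≡⟨ solve 1 (λ a → ⊝ a ⊕ (⊝ a ⊕ a) ⊕ a ⊜ id) refl a ⟩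
      ε                              ∎)

  module _ {a : Fin n} (a∉M : a ∉ M)
           (commutator∈⟨a²⟩ : ∀ g → InGen G (Commutators G M) g ⇔ InGen G (_≡ a ∙ a) g)
           (|a|≡4 : HasOrder G a 4) where

    private
      t = a ∙ a

    Z : Subset n
    Z = Centre G M

    Z≤ : IsSubgroup G Z
    Z≤ = Centre-isSubgroup M≤

    private
      module Z = Subgroup Z≤

    t²≡ε : t ∙ t ≡ ε
    t²≡ε = trans (solve 1 (λ a → a ⊕ a ⊕ (a ⊕ a) ⊜ id ⊕ a ⊕ a ⊕ a ⊕ a) refl a) (proj₁ (proj₂ |a|≡4))

    t≢ε : t ≢ ε
    t≢ε t≡ε = proj₂ (proj₂ |a|≡4) 2 (s≤s z≤n) (s≤s (s≤s (s≤s z≤n)))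
      (trans (cong (_∙ a) (identityˡ a)) t≡ε)

    t∈M : t ∈ M
    t∈M = outside-∙-outside a∉M a∉M

    ⟨t⟩⊆ : ∀ {g} → InGen G (_≡ t) g → (g ≡ ε) ⊎ (g ≡ t)
    ⟨t⟩⊆ (gen g≡t) = inj₂ g≡t
    ⟨t⟩⊆ one = inj₁ refl
    ⟨t⟩⊆ (mul p q) with ⟨t⟩⊆ p | ⟨t⟩⊆ q
    ... | inj₁ refl | inj₁ refl = inj₁ (identityˡ ε)
    ... | inj₁ refl | inj₂ refl = inj₂ (identityˡ _)
    ... | inj₂ refl | inj₁ refl = inj₂ (identityʳ _)
    ... | inj₂ refl | inj₂ refl = inj₁ t²≡ε
    ⟨t⟩⊆ (inv p) with ⟨t⟩⊆ p
    ... | inj₁ refl = inj₁ ε⁻¹≈ε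
      where open GroupProperties group using (ε⁻¹≈ε)
    ... | inj₂ refl = inj₂ (sym (inverseʳ-unique t t t²≡ε))
      where open GroupProperties group using (inverseʳ-unique)

    swap : ∀ x y → x ∙ y ≡ y ∙ x ∙ comm G x y
    swap = solve 2 (λ x y → x ⊕ y ⊜ y ⊕ x ⊕ (⊝ x ⊕ ⊝ y ⊕ x ⊕ y)) refl

    -- Commutators of `M` lie in the group generated by `t`, which consists of `ε` and `t` only.
    commute-up-to-t : ∀ {x y} → x ∈ M → y ∈ M → (x ∙ y ≡ y ∙ x) ⊎ (x ∙ y ≡ y ∙ x ∙ t)
    commute-up-to-t {x} {y} x∈M y∈M
      with ⟨t⟩⊆ (Equivalence.to (commutator∈⟨a²⟩ (comm G x y)) (gen (x , y , x∈M , y∈M , refl)))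
    ... | inj₁ ≡ε = inj₁ (trans (swap x y) (trans (cong (y ∙ x ∙_) ≡ε) (identityʳ _)))
    ... | inj₂ ≡t = inj₂ (trans (swap x y) (cong (y ∙ x ∙_) ≡t))

    -- The alternative `t y = y t t` collapses to `t y = y`, contrary to `t ≠ 1`.
    t∈Z : t ∈ Z
    t∈Z = Centre⁺ t∈M central
      where
      open GroupProperties group using (identityˡ-unique)
      central : ∀ {y} → y ∈ M → t ∙ y ≡ y ∙ t
      central {y} y∈M with commute-up-to-t t∈M y∈M
      ... | inj₁ ty≡yt = ty≡yt
      ... | inj₂ ty≡ytt = contradiction (identityˡ-unique t y (begin
        t ∙ y          ≡⟨ ty≡ytt ⟩
        y ∙ t ∙ t      ≡⟨ assoc y t t ⟩
        y ∙ (t ∙ t)    ≡⟨ cong (y ∙_) t²≡ε ⟩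
        y ∙ ε          ≡⟨ identityʳ y ⟩
        y              ∎)) t≢ε

    t∙ : ∀ {y} → y ∈ M → t ∙ y ≡ y ∙ t
    t∙ = Centre-central t∈Z

    -- Passing `y` across two copies of `x` costs either nothing or `t² = 1`.
    square∈Z : ∀ {x} → x ∈ M → x ∙ x ∈ Z
    square∈Z {x} x∈M = Centre⁺ (∙-∈ x∈M x∈M) central
      where
      central : ∀ {y} → y ∈ M → x ∙ x ∙ y ≡ y ∙ (x ∙ x)
      central {y} y∈M with commute-up-to-t x∈M y∈M
      ... | inj₁ xy≡yx = commute-∙ xy≡yx xy≡yx
      ... | inj₂ xy≡yxt = begin
        x ∙ x ∙ y              ≡⟨ assoc x x y ⟩
        x ∙ (x ∙ y)            ≡⟨ cong (x ∙_) xy≡yxt ⟩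
        x ∙ (y ∙ x ∙ t)        ≡⟨ solve 3 (λ x y t → x ⊕ (y ⊕ x ⊕ t) ⊜ x ⊕ y ⊕ (x ⊕ t)) refl x y t ⟩
        x ∙ y ∙ (x ∙ t)        ≡⟨ cong₂ _∙_ xy≡yxt (sym (t∙ x∈M)) ⟩
        y ∙ x ∙ t ∙ (t ∙ x)    ≡⟨ solve 3 (λ x y t → y ⊕ x ⊕ t ⊕ (t ⊕ x) ⊜ y ⊕ x ⊕ (t ⊕ t) ⊕ x) refl x y t ⟩
        y ∙ x ∙ (t ∙ t) ∙ x    ≡⟨ cong (λ u → y ∙ x ∙ u ∙ x) t²≡ε ⟩
        y ∙ x ∙ ε ∙ x          ≡⟨ solve 2 (λ x y → y ⊕ x ⊕ id ⊕ x ⊜ y ⊕ (x ⊕ x)) refl x y ⟩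
        y ∙ (x ∙ x)            ∎

    module _ (|M:Z|≡4 : Index G M Z 4) where

      -- Otherwise 1, x, y, xy and some w not commuting with x lie in five distinct cosets of Z.
      commute⇒∙-∈-Z : ∀ {x y} → x ∈ M → y ∈ M → x ∉ Z → y ∉ Z → x ∙ y ≡ y ∙ x → x ∙ y ∈ Z
      commute⇒∙-∈-Z {x} {y} x∈M y∈M x∉Z y∉Z xy≡yx = decidable-stable (x ∙ y ∈? Z) λ xy∉Z →
        contradiction
          (distinct-cosets⇒length≤index {k = 4} M≤ Z≤ Centre⊆ |M:Z|≡4 (ε ∷ x ∷ y ∷ x ∙ y ∷ w ∷ [])
            (ε-∈ ∷ x∈M ∷ y∈M ∷ ∙-∈ x∈M y∈M ∷ w∈M ∷ [])
            ( (x∉Z ∘ ε⁻¹∙ ∷ y∉Z ∘ ε⁻¹∙ ∷ xy∉Z ∘ ε⁻¹∙ ∷ w∉ commute-ε ∷ [])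
            ∷ ( (λ x⁻¹y∈Z → xy∉Z (subst (_∈ Z) (solve 2 (λ x y → x ⊕ x ⊕ (⊝ x ⊕ y) ⊜ x ⊕ y) refl x y)
                   (Z.∙-∈ (square∈Z x∈M) x⁻¹y∈Z)))
              ∷ y∉Z ∘ subst (_∈ Z) (solve 2 (λ x y → ⊝ x ⊕ (x ⊕ y) ⊜ y) refl x y)
              ∷ w∉ refl ∷ [])
            ∷ ( x∉Z ∘ subst (_∈ Z) (trans (cong (y ⁻¹ ∙_) xy≡yx) (solve 2 (λ x y → ⊝ y ⊕ (y ⊕ x) ⊜ x) refl x y))
              ∷ w∉ (sym xy≡yx) ∷ [])
            ∷ (w∉ (commute-∙ refl (sym xy≡yx)) ∷ [])
            ∷ [] ∷ []))
          λ { (s≤s (s≤s (s≤s (s≤s ())))) }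
        where
        ε⁻¹∙ : ∀ {u} → ε ⁻¹ ∙ u ∈ Z → u ∈ Z
        ε⁻¹∙ {u} = subst (_∈ Z) (solve 1 (λ u → ⊝ id ⊕ u ⊜ u) refl u)

        noncommuting : ∃[ w ] (w ∈ M × x ∙ w ≢ w ∙ x)
        noncommuting with any? (λ w → (w ∈? M) ×-dec ¬? (x ∙ w ≟ w ∙ x))
        ... | yes found = found
        ... | no  none  = contradiction (Centre⁺ x∈M λ {w} w∈M →
          decidable-stable (x ∙ w ≟ w ∙ x) (λ xw≢wx → none (w , w∈M , xw≢wx))) x∉Z

        w = proj₁ noncommuting
        w∈M = proj₁ (proj₂ noncommuting)

        -- The other four representatives commute with `x`. Were `u⁻¹ w` central, `w = u (u⁻¹ w)`
        -- would commute with `x` too.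
        w∉ : ∀ {u} → u ∙ x ≡ x ∙ u → u ⁻¹ ∙ w ∉ Z
        w∉ {u} ux≡xu u⁻¹w∈Z = proj₂ (proj₂ noncommuting) (sym
          (subst (λ v → v ∙ x ≡ x ∙ v) (solve 2 (λ u w → u ⊕ (⊝ u ⊕ w) ⊜ w) refl u w)
            (commute-∙ ux≡xu (Centre-central u⁻¹w∈Z x∈M))))

      -- φ fixes the coset aZ(M) pointwise and inverts the rest of the complement of M.
      invertedCentre⇒twist : (∀ z → z ∈ Z → conj G z a ≡ z ⁻¹) →
                             ∃[ m ] (m ∈ M × m ∉ Z × ¬ HasOrder G (a ∙ m) 2) → HasTwist
      invertedCentre⇒twist inverted (m , m∈M , m∉Z , |am|≢2) =
        Extension.twist {a} {a} {ψ} a∉M ψ-∙ (sym (ψ-∈ t∈Z)) ψ-conj off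
          (a ∙ m , outside-∙-inside a∉M m∈M , moves-am)
        where
        -- On the second branch, the value forced by `φ a = a` and `φ (a x) = (a x)⁻¹`.
        ψ : Fin n → Fin n
        ψ = piecewise Z (λ x → x) (λ x → a ⁻¹ ∙ x ⁻¹ ∙ a ⁻¹)

        ψ-∈ : ∀ {x} → x ∈ Z → ψ x ≡ x
        ψ-∈ = piecewise-∈ Z (λ x → x) (λ x → a ⁻¹ ∙ x ⁻¹ ∙ a ⁻¹)

        ψ-∉ : ∀ {x} → x ∉ Z → ψ x ≡ a ⁻¹ ∙ x ⁻¹ ∙ a ⁻¹
        ψ-∉ = piecewise-∉ Z (λ x → x) (λ x → a ⁻¹ ∙ x ⁻¹ ∙ a ⁻¹)

        ψ-∙ : ∀ {x y} → x ∈ M → y ∈ M → ψ (x ∙ y) ≡ ψ x ∙ ψ y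
        ψ-∙ {x} {y} x∈M y∈M = split (x ∈? Z) (y ∈? Z)
          where
          split : Dec (x ∈ Z) → Dec (y ∈ Z) → ψ (x ∙ y) ≡ ψ x ∙ ψ y
          split (yes x∈Z) (yes y∈Z) = trans (ψ-∈ (Z.∙-∈ x∈Z y∈Z)) (sym (cong₂ _∙_ (ψ-∈ x∈Z) (ψ-∈ y∈Z)))
          split (yes x∈Z) (no y∉Z) = begin
            ψ (x ∙ y)                             ≡⟨ ψ-∉ (y∉Z ∘ Z.∙-cancelˡ-∈ x∈Z) ⟩
            a ⁻¹ ∙ (x ∙ y) ⁻¹ ∙ a ⁻¹              ≡⟨ cong (λ u → a ⁻¹ ∙ u ⁻¹ ∙ a ⁻¹) (Centre-central x∈Z y∈M) ⟩
            a ⁻¹ ∙ (y ∙ x) ⁻¹ ∙ a ⁻¹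
              ≡⟨ solve 3 (λ a x y → ⊝ a ⊕ ⊝ (y ⊕ x) ⊕ ⊝ a ⊜ ⊝ (⊝ a ⊕ x ⊕ a) ⊕ (⊝ a ⊕ ⊝ y ⊕ ⊝ a)) refl a x y ⟩
            conj G x a ⁻¹ ∙ (a ⁻¹ ∙ y ⁻¹ ∙ a ⁻¹)  ≡⟨ cong (λ u → u ⁻¹ ∙ (a ⁻¹ ∙ y ⁻¹ ∙ a ⁻¹)) (inverted x x∈Z) ⟩
            x ⁻¹ ⁻¹ ∙ (a ⁻¹ ∙ y ⁻¹ ∙ a ⁻¹)        ≡⟨ solve 2 (λ x u → ⊝ ⊝ x ⊕ u ⊜ x ⊕ u) refl x _ ⟩
            x ∙ (a ⁻¹ ∙ y ⁻¹ ∙ a ⁻¹)              ≡⟨ cong₂ _∙_ (ψ-∈ x∈Z) (ψ-∉ y∉Z) ⟨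
            ψ x ∙ ψ y                             ∎
          split (no x∉Z) (yes y∈Z) = begin
            ψ (x ∙ y)                             ≡⟨ ψ-∉ (x∉Z ∘ Z.∙-cancelʳ-∈ y∈Z) ⟩
            a ⁻¹ ∙ (x ∙ y) ⁻¹ ∙ a ⁻¹              ≡⟨ cong (λ u → a ⁻¹ ∙ u ⁻¹ ∙ a ⁻¹) (Centre-central y∈Z x∈M) ⟨
            a ⁻¹ ∙ (y ∙ x) ⁻¹ ∙ a ⁻¹
              ≡⟨ solve 3 (λ a x y → ⊝ a ⊕ ⊝ (y ⊕ x) ⊕ ⊝ a ⊜ ⊝ a ⊕ ⊝ x ⊕ ⊝ y ⊕ ⊝ a) refl a x y ⟩
            a ⁻¹ ∙ x ⁻¹ ∙ y ⁻¹ ∙ a ⁻¹             ≡⟨ cong (λ u → a ⁻¹ ∙ x ⁻¹ ∙ u ∙ a ⁻¹) (inverted y y∈Z) ⟨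
            a ⁻¹ ∙ x ⁻¹ ∙ conj G y a ∙ a ⁻¹
              ≡⟨ solve 3 (λ a x y → ⊝ a ⊕ ⊝ x ⊕ (⊝ a ⊕ y ⊕ a) ⊕ ⊝ a ⊜ ⊝ a ⊕ ⊝ x ⊕ ⊝ a ⊕ y) refl a x y ⟩
            a ⁻¹ ∙ x ⁻¹ ∙ a ⁻¹ ∙ y                ≡⟨ cong₂ _∙_ (ψ-∉ x∉Z) (ψ-∈ y∈Z) ⟨
            ψ x ∙ ψ y                             ∎
          split (no x∉Z) (no y∉Z) = trans (split-product (x ∙ y ∈? Z)) (sym (cong₂ _∙_ (ψ-∉ x∉Z) (ψ-∉ y∉Z)))
            where
            split-product : Dec (x ∙ y ∈ Z) → ψ (x ∙ y) ≡ a ⁻¹ ∙ x ⁻¹ ∙ a ⁻¹ ∙ (a ⁻¹ ∙ y ⁻¹ ∙ a ⁻¹)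
            split-product (yes xy∈Z) = begin
              ψ (x ∙ y)                                  ≡⟨ ψ-∈ xy∈Z ⟩
              x ∙ y                                      ≡⟨ solve 1 (λ u → u ⊜ ⊝ ⊝ u ⊕ ⊝ id) refl (x ∙ y) ⟩
              -- The trivial factor `(t ∙ t) ⁻¹`, that is `a⁻⁴`, supplies the four letters `a⁻¹` of
              -- the right-hand side; conjugation by `a` contributes none on balance.
              (x ∙ y) ⁻¹ ⁻¹ ∙ ε ⁻¹                       ≡⟨ cong₂ (λ u v → u ⁻¹ ∙ v ⁻¹) (inverted _ xy∈Z) t²≡ε ⟨
              conj G (x ∙ y) a ⁻¹ ∙ (t ∙ t) ⁻¹           ≡⟨ cong (λ u → conj G u a ⁻¹ ∙ (t ∙ t) ⁻¹) xy≡yx ⟩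
              conj G (y ∙ x) a ⁻¹ ∙ (t ∙ t) ⁻¹
                ≡⟨ solve 3 (λ a x y → ⊝ (⊝ a ⊕ (y ⊕ x) ⊕ a) ⊕ ⊝ (a ⊕ a ⊕ (a ⊕ a)) ⊜
                                     ⊝ a ⊕ ⊝ x ⊕ ⊝ (a ⊕ a ⊕ y) ⊕ ⊝ a) refl a x y ⟩
              a ⁻¹ ∙ x ⁻¹ ∙ (t ∙ y) ⁻¹ ∙ a ⁻¹            ≡⟨ cong (λ u → a ⁻¹ ∙ x ⁻¹ ∙ u ⁻¹ ∙ a ⁻¹) (t∙ y∈M) ⟩
              a ⁻¹ ∙ x ⁻¹ ∙ (y ∙ t) ⁻¹ ∙ a ⁻¹
                ≡⟨ solve 3 (λ a x y → ⊝ a ⊕ ⊝ x ⊕ ⊝ (y ⊕ (a ⊕ a)) ⊕ ⊝ a ⊜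
                                     ⊝ a ⊕ ⊝ x ⊕ ⊝ a ⊕ (⊝ a ⊕ ⊝ y ⊕ ⊝ a)) refl a x y ⟩
              a ⁻¹ ∙ x ⁻¹ ∙ a ⁻¹ ∙ (a ⁻¹ ∙ y ⁻¹ ∙ a ⁻¹)  ∎
              where
              xy≡yx : x ∙ y ≡ y ∙ x
              xy≡yx = ∙-cancelˡ x _ _ (trans (sym (Centre-central xy∈Z x∈M)) (assoc x y x))
            split-product (no xy∉Z) with commute-up-to-t x∈M y∈M
            ... | inj₁ xy≡yx = contradiction (commute⇒∙-∈-Z x∈M y∈M x∉Z y∉Z xy≡yx) xy∉Z
            -- The `t` by which `x` and `y` fail to commute becomes the pair `a⁻¹ a⁻¹` in the middle
            -- of the target.
            ... | inj₂ xy≡yxt = begin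
              ψ (x ∙ y)                                  ≡⟨ ψ-∉ xy∉Z ⟩
              a ⁻¹ ∙ (x ∙ y) ⁻¹ ∙ a ⁻¹                   ≡⟨ cong (λ u → a ⁻¹ ∙ u ⁻¹ ∙ a ⁻¹) xy≡yxt ⟩
              a ⁻¹ ∙ (y ∙ x ∙ t) ⁻¹ ∙ a ⁻¹
                ≡⟨ cong (λ u → a ⁻¹ ∙ u ⁻¹ ∙ a ⁻¹) (trans (assoc y x t) (cong (y ∙_) (sym (t∙ x∈M)))) ⟩
              a ⁻¹ ∙ (y ∙ (t ∙ x)) ⁻¹ ∙ a ⁻¹
                ≡⟨ solve 3 (λ a x y → ⊝ a ⊕ ⊝ (y ⊕ (a ⊕ a ⊕ x)) ⊕ ⊝ a ⊜
                                     ⊝ a ⊕ ⊝ x ⊕ ⊝ a ⊕ (⊝ a ⊕ ⊝ y ⊕ ⊝ a)) refl a x y ⟩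
              a ⁻¹ ∙ x ⁻¹ ∙ a ⁻¹ ∙ (a ⁻¹ ∙ y ⁻¹ ∙ a ⁻¹)  ∎

        open Inverted Z≤ inverted

        ψ-conj : ∀ {m} → m ∈ M → ψ m ∙ a ≡ a ∙ ψ (conj G m a)
        ψ-conj {m} _ = split (m ∈? Z)
          where
          split : Dec (m ∈ Z) → ψ m ∙ a ≡ a ∙ ψ (conj G m a)
          split (yes m∈Z) = begin
            ψ m ∙ a                 ≡⟨ cong (_∙ a) (ψ-∈ m∈Z) ⟩
            m ∙ a                   ≡⟨ solve 2 (λ a m → m ⊕ a ⊜ a ⊕ (⊝ a ⊕ m ⊕ a)) refl a m ⟩
            a ∙ conj G m a          ≡⟨ cong (a ∙_) (ψ-∈ (conj-∈-Z m∈Z)) ⟨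
            a ∙ ψ (conj G m a)      ∎
          split (no m∉Z) = begin
            ψ m ∙ a                 ≡⟨ cong (_∙ a) (ψ-∉ m∉Z) ⟩
            a ⁻¹ ∙ m ⁻¹ ∙ a ⁻¹ ∙ a
              ≡⟨ solve 2 (λ a m → ⊝ a ⊕ ⊝ m ⊕ ⊝ a ⊕ a ⊜ a ⊕ (⊝ a ⊕ ⊝ (⊝ a ⊕ m ⊕ a) ⊕ ⊝ a)) refl a m ⟩
            a ∙ (a ⁻¹ ∙ conj G m a ⁻¹ ∙ a ⁻¹)  ≡⟨ cong (a ∙_) (ψ-∉ (conj-∉-Z m∉Z)) ⟨
            a ∙ ψ (conj G m a)      ∎

        off : ∀ {g} → g ∉ M → (a ∙ ψ (a ⁻¹ ∙ g) ≡ g) ⊎ (a ∙ ψ (a ⁻¹ ∙ g) ≡ g ⁻¹)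
        off {g} _ = split (a ⁻¹ ∙ g ∈? Z)
          where
          split : Dec (a ⁻¹ ∙ g ∈ Z) → (a ∙ ψ (a ⁻¹ ∙ g) ≡ g) ⊎ (a ∙ ψ (a ⁻¹ ∙ g) ≡ g ⁻¹)
          split (yes ∈Z) = inj₁ (trans (cong (a ∙_) (ψ-∈ ∈Z)) (solve 2 (λ a g → a ⊕ (⊝ a ⊕ g) ⊜ g) refl a g))
          split (no ∉Z) = inj₂ (trans (cong (a ∙_) (ψ-∉ ∉Z))
            (solve 2 (λ a g → a ⊕ (⊝ a ⊕ ⊝ (⊝ a ⊕ g) ⊕ ⊝ a) ⊜ ⊝ g) refl a g))

        -- `a m` is sent to its inverse, so fixing it would give `(a m)² = 1`; lying outside `M`, it
        -- is not `ε`, and its order would be exactly two.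
        moves-am : a ∙ ψ (a ⁻¹ ∙ (a ∙ m)) ≢ a ∙ m
        moves-am fixed = |am|≢2 (s≤s z≤n , (begin
          ε ∙ (a ∙ m) ∙ (a ∙ m)                         ≡⟨ cong (ε ∙ (a ∙ m) ∙_) fixed ⟨
          ε ∙ (a ∙ m) ∙ (a ∙ ψ (a ⁻¹ ∙ (a ∙ m)))
            ≡⟨ cong (λ u → ε ∙ (a ∙ m) ∙ (a ∙ ψ u)) (solve 2 (λ a m → ⊝ a ⊕ (a ⊕ m) ⊜ m) refl a m) ⟩
          ε ∙ (a ∙ m) ∙ (a ∙ ψ m)                       ≡⟨ cong (λ u → ε ∙ (a ∙ m) ∙ (a ∙ u)) (ψ-∉ m∉Z) ⟩
          ε ∙ (a ∙ m) ∙ (a ∙ (a ⁻¹ ∙ m ⁻¹ ∙ a ⁻¹))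
            ≡⟨ solve 2 (λ a m → id ⊕ (a ⊕ m) ⊕ (a ⊕ (⊝ a ⊕ ⊝ m ⊕ ⊝ a)) ⊜ id) refl a m ⟩
          ε                                             ∎)
          , λ { (suc zero) _ _ am≡ε → outside-∙-inside a∉M m∈M (subst (_∈ M) (trans (sym am≡ε) (identityˡ _)) ε-∈)
              ; (suc (suc _)) _ (s≤s (s≤s ())) _ })

-- Necessity: the fixed points of `φ` in `M`.

module Necessity (G : FinGroup) {M : Subset (FinGroup.n G)}
                 (M≤ : IsSubgroup G M) (|G:M|≡2 : Index G ⊤ M 2) where
  open FiniteGroup G
  open Subgroup M≤
  open IndexTwo G M≤ |G:M|≡2
  open Group group using (assoc; identityˡ; identityʳ; inverseˡ)
  open GroupProperties group using (∙-cancelˡ; ∙-cancelʳ; inverseʳ-unique)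

  module _ {φ : Fin n → Fin n} (φ-∙ : ∀ x y → φ (x ∙ y) ≡ φ x ∙ φ y) (fi : FixesOrInverts φ) where
    open Homomorphism φ-∙ using (φ-ε; φ-⁻¹; agree-outside⇒agree)

    -- In a generalised dihedral group every element outside `M` is an involution, so inverting it
    -- is fixing it, and `φ` agrees with the identity on a generating set.
    dihedral⇒fixes : GeneralisedDihedralOn G M → ∀ g → φ g ≡ g
    dihedral⇒fixes (_ , _ , _ , ι , ι∉M , _ , ι²≡ε , inverted) = agree-outside⇒agree (λ _ _ → refl) fixes
      where
      involution : ∀ {g} → g ∉ M → g ∙ g ≡ ε
      involution {g} g∉M = begin
        g ∙ g
          ≡⟨ solve 2 (λ g ι → g ⊕ g ⊜ ι ⊕ ι ⊕ (⊝ ι ⊕ (⊝ ι ⊕ g) ⊕ ι) ⊕ (⊝ ι ⊕ g)) refl g ι ⟩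
        ι ∙ ι ∙ conj G (ι ⁻¹ ∙ g) ι ∙ (ι ⁻¹ ∙ g)
          ≡⟨ cong₂ (λ u v → u ∙ v ∙ (ι ⁻¹ ∙ g)) ι²≡ε (inverted _ (outside-∙-outside (outside-⁻¹ ι∉M) g∉M)) ⟩
        ε ∙ (ι ⁻¹ ∙ g) ⁻¹ ∙ (ι ⁻¹ ∙ g)
          ≡⟨ solve 1 (λ u → id ⊕ ⊝ u ⊕ u ⊜ id) refl (ι ⁻¹ ∙ g) ⟩
        ε ∎

      fixes : ∀ g → g ∉ M → φ g ≡ g
      fixes g g∉M with fi g g∉M
      ... | inj₁ φg≡g   = φg≡g
      ... | inj₂ φg≡g⁻¹ = trans φg≡g⁻¹ (sym (inverseʳ-unique g g (involution g∉M)))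

    -- On `M` the map `φ` becomes `m ↦ a m⁻¹ a⁻¹`, which reverses products; being a homomorphism as
    -- well, it forces `M` to be abelian.
    inverts-outside⇒abelian : (∀ g → g ∉ M → φ g ≡ g ⁻¹) → IsAbelianSub G M
    inverts-outside⇒abelian inverts x y x∈M y∈M = ⁻¹-injective (∙-cancelˡ a _ _ (∙-cancelʳ (a ⁻¹) _ _ (begin
      a ∙ (x ∙ y) ⁻¹ ∙ a ⁻¹                  ≡⟨ φ≡ (∙-∈ x∈M y∈M) ⟨
      φ (x ∙ y)                              ≡⟨ φ-∙ x y ⟩
      φ x ∙ φ y                              ≡⟨ cong₂ _∙_ (φ≡ x∈M) (φ≡ y∈M) ⟩
      a ∙ x ⁻¹ ∙ a ⁻¹ ∙ (a ∙ y ⁻¹ ∙ a ⁻¹)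
        ≡⟨ solve 3 (λ a x y → a ⊕ ⊝ x ⊕ ⊝ a ⊕ (a ⊕ ⊝ y ⊕ ⊝ a) ⊜ a ⊕ ⊝ (y ⊕ x) ⊕ ⊝ a) refl a x y ⟩
      a ∙ (y ∙ x) ⁻¹ ∙ a ⁻¹                  ∎)))
      where
      open GroupProperties group using (⁻¹-injective)
      a = proj₁ ∃∉M
      a∉M = proj₂ ∃∉M

      φ≡ : ∀ {m} → m ∈ M → φ m ≡ a ∙ m ⁻¹ ∙ a ⁻¹
      φ≡ {m} m∈M = ∙-cancelˡ (φ a) _ _ (begin
        φ a ∙ φ m                      ≡⟨ φ-∙ a m ⟨
        φ (a ∙ m)                      ≡⟨ inverts _ (outside-∙-inside a∉M m∈M) ⟩
        (a ∙ m) ⁻¹                     ≡⟨ solve 2 (λ a m → ⊝ (a ⊕ m) ⊜ ⊝ a ⊕ (a ⊕ ⊝ m ⊕ ⊝ a)) refl a m ⟩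
        a ⁻¹ ∙ (a ∙ m ⁻¹ ∙ a ⁻¹)       ≡⟨ cong (_∙ (a ∙ m ⁻¹ ∙ a ⁻¹)) (inverts a a∉M) ⟨
        φ a ∙ (a ∙ m ⁻¹ ∙ a ⁻¹)        ∎)

    inFixed? : ∀ x → Dec (x ∈ M × φ x ≡ x)
    inFixed? x = (x ∈? M) ×-dec (φ x ≟ x)

    Fixed : Subset n
    Fixed = Vec.tabulate (λ x → ⌊ inFixed? x ⌋)

    Fixed⁺ : ∀ {x} → x ∈ M → φ x ≡ x → x ∈ Fixed
    Fixed⁺ x∈M φx≡x = ∈-tabulate⁺ inFixed? (x∈M , φx≡x)

    Fixed⊆M : Fixed ⊆ M
    Fixed⊆M x∈K = proj₁ (∈-tabulate⁻ inFixed? x∈K)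

    Fixed-fixed : ∀ {x} → x ∈ Fixed → φ x ≡ x
    Fixed-fixed x∈K = proj₂ (∈-tabulate⁻ inFixed? x∈K)

    Fixed-isSubgroup : IsSubgroup G Fixed
    Fixed-isSubgroup = Fixed⁺ ε-∈ φ-ε
      , (λ x y x∈K y∈K → Fixed⁺ (∙-∈ (Fixed⊆M x∈K) (Fixed⊆M y∈K))
          (trans (φ-∙ x y) (cong₂ _∙_ (Fixed-fixed x∈K) (Fixed-fixed y∈K))))
      , (λ x x∈K → Fixed⁺ (⁻¹-∈ (Fixed⊆M x∈K)) (trans (φ-⁻¹ x) (cong _⁻¹ (Fixed-fixed x∈K))))

    module FixedOutside {b : Fin n} (b∉M : b ∉ M) (φb≡b : φ b ≡ b) where

      private
        module K = Subgroup Fixed-isSubgroup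
        t = b ∙ b

      -- If `b m` were fixed along with `b`, then `m` would be fixed.
      b∙-inverted : ∀ {m} → m ∈ M → m ∉ Fixed → φ (b ∙ m) ≡ (b ∙ m) ⁻¹
      b∙-inverted {m} m∈M m∉K with fi (b ∙ m) (outside-∙-inside b∉M m∈M)
      ... | inj₂ inverts = inverts
      ... | inj₁ fixes   = contradiction (Fixed⁺ m∈M (∙-cancelˡ b _ _ (begin
        b ∙ φ m      ≡⟨ cong (_∙ φ m) φb≡b ⟨
        φ b ∙ φ m    ≡⟨ φ-∙ b m ⟨
        φ (b ∙ m)    ≡⟨ fixes ⟩
        b ∙ m        ∎))) m∉K

      φ-off-Fixed : ∀ {m} → m ∈ M → m ∉ Fixed → φ m ≡ b ⁻¹ ∙ (b ∙ m) ⁻¹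
      φ-off-Fixed {m} m∈M m∉K = begin
        φ m                     ≡⟨ solve 2 (λ b u → u ⊜ ⊝ b ⊕ (b ⊕ u)) refl b (φ m) ⟩
        b ⁻¹ ∙ (b ∙ φ m)        ≡⟨ cong (λ u → b ⁻¹ ∙ (u ∙ φ m)) φb≡b ⟨
        b ⁻¹ ∙ (φ b ∙ φ m)      ≡⟨ cong (b ⁻¹ ∙_) (φ-∙ b m) ⟨
        b ⁻¹ ∙ φ (b ∙ m)        ≡⟨ cong (b ⁻¹ ∙_) (b∙-inverted m∈M m∉K) ⟩
        b ⁻¹ ∙ (b ∙ m) ⁻¹       ∎

      -- An involution that is inverted is fixed. This yields `a² ≠ 1` in (2) and `o(am) ≠ 2` in
      -- (3).
      bm-nonInvolution : ∀ {m} → m ∈ M → m ∉ Fixed → b ∙ m ∙ (b ∙ m) ≢ ε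
      bm-nonInvolution {m} m∈M m∉K bmbm≡ε = m∉K (Fixed⁺ m∈M (begin
        φ m                    ≡⟨ φ-off-Fixed m∈M m∉K ⟩
        b ⁻¹ ∙ (b ∙ m) ⁻¹      ≡⟨ cong (b ⁻¹ ∙_) (inverseʳ-unique _ _ bmbm≡ε) ⟨
        b ⁻¹ ∙ (b ∙ m)         ≡⟨ solve 2 (λ b m → ⊝ b ⊕ (b ⊕ m) ⊜ m) refl b m ⟩
        m                      ∎))

      -- Compare φ (k m) with φ k φ m.
      bkb⁻¹ : ∀ {k m} → k ∈ Fixed → m ∈ M → m ∉ Fixed → b ∙ k ∙ b ⁻¹ ≡ m ⁻¹ ∙ k ⁻¹ ∙ m
      bkb⁻¹ {k} {m} k∈K m∈M m∉K = begin
        b ∙ k ∙ b ⁻¹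
          ≡⟨ solve 3 (λ b k m → b ⊕ k ⊕ ⊝ b ⊜ b ⊕ (k ⊕ (⊝ b ⊕ ⊝ (b ⊕ m))) ⊕ b ⊕ m) refl b k m ⟩
        b ∙ (k ∙ (b ⁻¹ ∙ (b ∙ m) ⁻¹)) ∙ b ∙ m
          ≡⟨ cong₂ (λ u v → b ∙ (u ∙ v) ∙ b ∙ m) (Fixed-fixed k∈K) (φ-off-Fixed m∈M m∉K) ⟨
        b ∙ (φ k ∙ φ m) ∙ b ∙ m
          ≡⟨ cong (λ u → b ∙ u ∙ b ∙ m) (φ-∙ k m) ⟨
        b ∙ φ (k ∙ m) ∙ b ∙ m
          ≡⟨ cong (λ u → b ∙ u ∙ b ∙ m) (φ-off-Fixed (∙-∈ (Fixed⊆M k∈K) m∈M) (m∉K ∘ K.∙-cancelˡ-∈ k∈K)) ⟩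
        b ∙ (b ⁻¹ ∙ (b ∙ (k ∙ m)) ⁻¹) ∙ b ∙ m
          ≡⟨ solve 3 (λ b k m → b ⊕ (⊝ b ⊕ ⊝ (b ⊕ (k ⊕ m))) ⊕ b ⊕ m ⊜ ⊝ m ⊕ ⊝ k ⊕ m) refl b k m ⟩
        m ⁻¹ ∙ k ⁻¹ ∙ m ∎

      -- Compare φ (m k) with φ m φ k.
      b⁻¹kb : ∀ {k m} → k ∈ Fixed → m ∈ M → m ∉ Fixed → b ⁻¹ ∙ k ∙ b ≡ m ∙ k ⁻¹ ∙ m ⁻¹
      b⁻¹kb {k} {m} k∈K m∈M m∉K = begin
        b ⁻¹ ∙ k ∙ b
          ≡⟨ solve 3 (λ b k m → ⊝ b ⊕ k ⊕ b ⊜ m ⊕ b ⊕ (⊝ b ⊕ ⊝ (b ⊕ m) ⊕ k) ⊕ b) refl b k m ⟩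
        m ∙ b ∙ (b ⁻¹ ∙ (b ∙ m) ⁻¹ ∙ k) ∙ b
          ≡⟨ cong₂ (λ u v → m ∙ b ∙ (u ∙ v) ∙ b) (φ-off-Fixed m∈M m∉K) (Fixed-fixed k∈K) ⟨
        m ∙ b ∙ (φ m ∙ φ k) ∙ b
          ≡⟨ cong (λ u → m ∙ b ∙ u ∙ b) (φ-∙ m k) ⟨
        m ∙ b ∙ φ (m ∙ k) ∙ b
          ≡⟨ cong (λ u → m ∙ b ∙ u ∙ b) (φ-off-Fixed (∙-∈ m∈M (Fixed⊆M k∈K)) (m∉K ∘ K.∙-cancelʳ-∈ k∈K)) ⟩
        m ∙ b ∙ (b ⁻¹ ∙ (b ∙ (m ∙ k)) ⁻¹) ∙ b
          ≡⟨ solve 3 (λ b k m → m ⊕ b ⊕ (⊝ b ⊕ ⊝ (b ⊕ (m ⊕ k))) ⊕ b ⊜ m ⊕ ⊝ k ⊕ ⊝ m) refl b k m ⟩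
        m ∙ k ⁻¹ ∙ m ⁻¹ ∎

      b²∈Fixed : t ∈ Fixed
      b²∈Fixed = Fixed⁺ (outside-∙-outside b∉M b∉M) (trans (φ-∙ b b) (cong₂ _∙_ φb≡b φb≡b))

      module _ {m₁ : Fin n} (m₁∈M : m₁ ∈ M) (m₁∉K : m₁ ∉ Fixed) where

        -- The map k ↦ b k b⁻¹ is multiplicative, and by bkb⁻¹ it is antimultiplicative on Fixed.
        Fixed-abelian : IsAbelianSub G Fixed
        Fixed-abelian x y x∈K y∈K = ∙-cancelˡ b _ _ (∙-cancelʳ (b ⁻¹) _ _ (begin
          b ∙ (x ∙ y) ∙ b ⁻¹                            ≡⟨ bkb⁻¹ (K.∙-∈ x∈K y∈K) m₁∈M m₁∉K ⟩
          m₁ ⁻¹ ∙ (x ∙ y) ⁻¹ ∙ m₁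
            ≡⟨ solve 3 (λ m x y → ⊝ m ⊕ ⊝ (x ⊕ y) ⊕ m ⊜ (⊝ m ⊕ ⊝ y ⊕ m) ⊕ (⊝ m ⊕ ⊝ x ⊕ m)) refl m₁ x y ⟩
          m₁ ⁻¹ ∙ y ⁻¹ ∙ m₁ ∙ (m₁ ⁻¹ ∙ x ⁻¹ ∙ m₁)
            ≡⟨ cong₂ _∙_ (bkb⁻¹ y∈K m₁∈M m₁∉K) (bkb⁻¹ x∈K m₁∈M m₁∉K) ⟨
          b ∙ y ∙ b ⁻¹ ∙ (b ∙ x ∙ b ⁻¹)
            ≡⟨ solve 3 (λ b x y → b ⊕ y ⊕ ⊝ b ⊕ (b ⊕ x ⊕ ⊝ b) ⊜ b ⊕ (y ⊕ x) ⊕ ⊝ b) refl b x y ⟩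
          b ∙ (y ∙ x) ∙ b ⁻¹                            ∎))

        -- The hypothesis says that `ε` and `m₁` suffice to carry all of `M` into `Fixed`. The
        -- substantial point is that `a²` is central in the whole group.
        index-two⇒cond2 : (∀ {x} → x ∈ M → x ∉ Fixed → m₁ ∙ x ∈ Fixed) → Cond2 G M
        index-two⇒cond2 m₁∙∈K =
          Fixed , Fixed-isSubgroup , Fixed⊆M , Fixed-abelian , |M:K|≡2 , a
            , outside-∙-inside b∉M m₁∈M , bm-nonInvolution m₁∈M m₁∉K , a²∈K
            , Centre⁺ ∈⊤ (λ _ → sym a²-central) , λ z z∈K → inverted z∈K
          where
          a = b ∙ m₁

          |M:K|≡2 : Index G M Fixed 2
          |M:K|≡2 = ℕ.≤-antisym (cosets-cover⇒≤ (ε ∷ m₁ ∷ []) cover)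
            (distinct-cosets⇒≤ M≤ Fixed-isSubgroup Fixed⊆M (ε ∷ m₁ ∷ []) (ε-∈ ∷ m₁∈M ∷ [])
              (((λ ∈K → m₁∉K (subst (_∈ Fixed) (solve 1 (λ m → ⊝ id ⊕ m ⊜ m) refl m₁) ∈K)) ∷ []) ∷ [] ∷ []))
            where
            cover : ∀ {h} → h ∈ M → Any (λ r → r ∙ h ∈ Fixed) (ε ∷ m₁ ∷ [])
            cover {h} h∈M with h ∈? Fixed
            ... | yes h∈K = here (subst (_∈ Fixed) (sym (identityˡ h)) h∈K)
            ... | no  h∉K = there (here (m₁∙∈K h∈M h∉K))

          ∙∈K : ∀ {x y} → x ∈ M → y ∈ M → x ∉ Fixed → y ∉ Fixed → x ∙ y ∈ Fixed
          ∙∈K = index-two⇒∙-∈ M≤ Fixed-isSubgroup Fixed⊆M |M:K|≡2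

          inverted : ∀ {z} → z ∈ Fixed → conj G z a ≡ z ⁻¹
          inverted {z} z∈K = begin
            a ⁻¹ ∙ z ∙ a
              ≡⟨ solve 3 (λ b m z → ⊝ (b ⊕ m) ⊕ z ⊕ (b ⊕ m) ⊜ ⊝ m ⊕ (⊝ b ⊕ z ⊕ b) ⊕ m) refl b m₁ z ⟩
            -- By `b⁻¹kb`, conjugation by `b` is inversion followed by a conjugation that `m₁`
            -- undoes.
            m₁ ⁻¹ ∙ (b ⁻¹ ∙ z ∙ b) ∙ m₁       ≡⟨ cong (λ u → m₁ ⁻¹ ∙ u ∙ m₁) (b⁻¹kb z∈K m₁∈M m₁∉K) ⟩
            m₁ ⁻¹ ∙ (m₁ ∙ z ⁻¹ ∙ m₁ ⁻¹) ∙ m₁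
              ≡⟨ solve 2 (λ m z → ⊝ m ⊕ (m ⊕ ⊝ z ⊕ ⊝ m) ⊕ m ⊜ ⊝ z) refl m₁ z ⟩
            z ⁻¹                              ∎

          m₁ᵇ∈M : conj G m₁ b ∈ M
          m₁ᵇ∈M = conj-∈ m₁∈M b∉M

          -- `φ` commutes with conjugation by the fixed `b`, so a fixed conjugate would make `m₁`
          -- fixed.
          m₁ᵇ∉K : conj G m₁ b ∉ Fixed
          m₁ᵇ∉K ∈K = m₁∉K (Fixed⁺ m₁∈M (∙-cancelˡ (b ⁻¹) _ _ (∙-cancelʳ b _ _ (begin
            b ⁻¹ ∙ φ m₁ ∙ b         ≡⟨ cong₂ (λ u v → u ⁻¹ ∙ φ m₁ ∙ v) φb≡b φb≡b ⟨
            φ b ⁻¹ ∙ φ m₁ ∙ φ b     ≡⟨ cong (λ u → u ∙ φ m₁ ∙ φ b) (φ-⁻¹ b) ⟨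
            φ (b ⁻¹) ∙ φ m₁ ∙ φ b   ≡⟨ cong (_∙ φ b) (φ-∙ _ _) ⟨
            φ (b ⁻¹ ∙ m₁) ∙ φ b     ≡⟨ φ-∙ _ _ ⟨
            φ (b ⁻¹ ∙ m₁ ∙ b)       ≡⟨ Fixed-fixed ∈K ⟩
            b ⁻¹ ∙ m₁ ∙ b           ∎))))

          -- `a² = b² (m₁ᵇ m₁)`, and the two factors in parentheses are both off `Fixed`, which has
          -- index two.
          a²∈K : a ∙ a ∈ Fixed
          a²∈K = subst (_∈ Fixed)
            (solve 2 (λ b m → b ⊕ b ⊕ (⊝ b ⊕ m ⊕ b ⊕ m) ⊜ b ⊕ m ⊕ (b ⊕ m)) refl b m₁)
            (K.∙-∈ b²∈Fixed (∙∈K m₁ᵇ∈M m₁∈M m₁ᵇ∉K m₁∉K))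

          -- a^b lies in the coset a Fixed, all elements of which have the same square.
          b-commutes : b ∙ (a ∙ a) ≡ a ∙ a ∙ b
          b-commutes = begin
            b ∙ (a ∙ a)
              ≡⟨ cong (b ∙_) (sym same-square) ⟩
            b ∙ (a ∙ k ∙ (a ∙ k))
              ≡⟨ solve 2 (λ b m → let a = b ⊕ m; k = ⊝ m ⊕ (⊝ b ⊕ m ⊕ b) in
                    b ⊕ (a ⊕ k ⊕ (a ⊕ k)) ⊜ a ⊕ a ⊕ b) refl b m₁ ⟩
            a ∙ a ∙ b ∎
            where
            -- Chosen so that `a ∙ k` is the conjugate of `a` by `b`.
            k = m₁ ⁻¹ ∙ conj G m₁ b
            k∈K : k ∈ Fixed
            k∈K = ∙∈K (⁻¹-∈ m₁∈M) m₁ᵇ∈M (m₁∉K ∘ K.⁻¹-∈⁻) m₁ᵇ∉K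
            same-square : a ∙ k ∙ (a ∙ k) ≡ a ∙ a
            same-square = begin
              a ∙ k ∙ (a ∙ k)
                ≡⟨ solve 2 (λ a k → a ⊕ k ⊕ (a ⊕ k) ⊜ a ⊕ a ⊕ (⊝ a ⊕ k ⊕ a) ⊕ k) refl a k ⟩
              a ∙ a ∙ conj G k a ∙ k   ≡⟨ cong (λ u → a ∙ a ∙ u ∙ k) (inverted k∈K) ⟩
              a ∙ a ∙ k ⁻¹ ∙ k         ≡⟨ solve 2 (λ a k → a ⊕ a ⊕ ⊝ k ⊕ k ⊜ a ⊕ a) refl a k ⟩
              a ∙ a                    ∎

          K-commutes : ∀ {y} → y ∈ Fixed → y ∙ (a ∙ a) ≡ a ∙ a ∙ y
          K-commutes y∈K = Fixed-abelian _ _ y∈K a²∈K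

          -- `m₁ = b⁻¹ a`, and both factors commute with `a²`. Together with `Fixed` and `b`, `m₁`
          -- generates the group.
          m₁-commutes : m₁ ∙ (a ∙ a) ≡ a ∙ a ∙ m₁
          m₁-commutes = subst (λ u → u ∙ (a ∙ a) ≡ a ∙ a ∙ u)
            (solve 2 (λ b m → ⊝ b ⊕ (b ⊕ m) ⊜ m) refl b m₁)
            (commute-∙ (commute-⁻¹ b-commutes) (sym (assoc a a a)))

          M-commutes : ∀ {y} → y ∈ M → y ∙ (a ∙ a) ≡ a ∙ a ∙ y
          M-commutes {y} y∈M with y ∈? Fixed
          ... | yes y∈K = K-commutes y∈K
          ... | no  y∉K = subst (λ u → u ∙ (a ∙ a) ≡ a ∙ a ∙ u)
            (solve 2 (λ m y → ⊝ m ⊕ (m ⊕ y) ⊜ y) refl m₁ y)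
            (commute-∙ (commute-⁻¹ m₁-commutes) (K-commutes (m₁∙∈K y∈M y∉K)))

          a²-central : ∀ {y} → y ∙ (a ∙ a) ≡ a ∙ a ∙ y
          a²-central {y} with y ∈? M
          ... | yes y∈M = M-commutes y∈M
          ... | no  y∉M = subst (λ u → u ∙ (a ∙ a) ≡ a ∙ a ∙ u)
            (solve 2 (λ b y → b ⊕ (⊝ b ⊕ y) ⊜ y) refl b y)
            (commute-∙ b-commutes (M-commutes (outside-∙-outside (outside-⁻¹ b∉M) y∉M)))

        -- Necessity of (3): two elements off `Fixed` whose product is off `Fixed`.

        module _ {m₂ : Fin n} (m₂∈M : m₂ ∈ M) (m₂∉K : m₂ ∉ Fixed) (m₁m₂∉K : m₁ ∙ m₂ ∉ Fixed)
                 (nonabelian : ¬ IsAbelianSub G M) where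

          private
            m₁m₂∈M = ∙-∈ m₁∈M m₂∈M

          -- By bkb⁻¹, the elements m₁, m₂ and m₁ m₂ conjugate k⁻¹ to the same element.
          b-inverts : ∀ {k} → k ∈ Fixed → b ∙ k ∙ b ⁻¹ ≡ k ⁻¹
          b-inverts {k} k∈K = begin
            b ∙ k ∙ b ⁻¹
              ≡⟨ solve 2 (λ w m → w ⊜ m ⊕ (⊝ m ⊕ w ⊕ m) ⊕ ⊝ m) refl (b ∙ k ∙ b ⁻¹) m₂ ⟩
            m₂ ∙ (m₂ ⁻¹ ∙ (b ∙ k ∙ b ⁻¹) ∙ m₂) ∙ m₂ ⁻¹
              ≡⟨ cong (λ u → m₂ ∙ (m₂ ⁻¹ ∙ u ∙ m₂) ∙ m₂ ⁻¹) (bkb⁻¹ k∈K m₁∈M m₁∉K) ⟩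
            m₂ ∙ (m₂ ⁻¹ ∙ (m₁ ⁻¹ ∙ k ⁻¹ ∙ m₁) ∙ m₂) ∙ m₂ ⁻¹
              ≡⟨ cong (λ u → m₂ ∙ u ∙ m₂ ⁻¹) (trans
                   (solve 3 (λ k m l → ⊝ l ⊕ (⊝ m ⊕ ⊝ k ⊕ m) ⊕ l ⊜ ⊝ (m ⊕ l) ⊕ ⊝ k ⊕ (m ⊕ l)) refl k m₁ m₂)
                   (trans (sym (bkb⁻¹ k∈K m₁m₂∈M m₁m₂∉K)) (bkb⁻¹ k∈K m₂∈M m₂∉K))) ⟩
            m₂ ∙ (m₂ ⁻¹ ∙ k ⁻¹ ∙ m₂) ∙ m₂ ⁻¹
              ≡⟨ solve 2 (λ k m → m ⊕ (⊝ m ⊕ ⊝ k ⊕ m) ⊕ ⊝ m ⊜ ⊝ k) refl k m₂ ⟩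
            k ⁻¹ ∎

          -- For `m` off `Fixed`, `bkb⁻¹` and `b-inverts` give two values of the same conjugate:
          -- `m⁻¹ k⁻¹ m = k⁻¹`.
          K-central : ∀ {k m} → k ∈ Fixed → m ∈ M → k ∙ m ≡ m ∙ k
          K-central {k} {m} k∈K m∈M with m ∈? Fixed
          ... | yes m∈K = Fixed-abelian _ _ k∈K m∈K
          ... | no  m∉K = begin
            k ∙ m                         ≡⟨ solve 2 (λ k m → k ⊕ m ⊜ m ⊕ ⊝ (⊝ m ⊕ ⊝ k ⊕ m)) refl k m ⟩
            m ∙ (m ⁻¹ ∙ k ⁻¹ ∙ m) ⁻¹      ≡⟨ cong (λ u → m ∙ u ⁻¹) (bkb⁻¹ k∈K m∈M m∉K) ⟨
            m ∙ (b ∙ k ∙ b ⁻¹) ⁻¹         ≡⟨ cong (λ u → m ∙ u ⁻¹) (b-inverts k∈K) ⟩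
            m ∙ k ⁻¹ ⁻¹                   ≡⟨ solve 2 (λ k m → m ⊕ ⊝ ⊝ k ⊜ m ⊕ k) refl k m ⟩
            m ∙ k                         ∎

          conj-inverts : ∀ {k} → k ∈ Fixed → conj G k b ≡ k ⁻¹
          conj-inverts {k} k∈K = begin
            b ⁻¹ ∙ k ∙ b                  ≡⟨ solve 2 (λ b k → ⊝ b ⊕ k ⊕ b ⊜ ⊝ b ⊕ ⊝ ⊝ k ⊕ b) refl b k ⟩
            b ⁻¹ ∙ k ⁻¹ ⁻¹ ∙ b            ≡⟨ cong (λ u → b ⁻¹ ∙ u ⁻¹ ∙ b) (b-inverts k∈K) ⟨
            b ⁻¹ ∙ (b ∙ k ∙ b ⁻¹) ⁻¹ ∙ b
              ≡⟨ solve 2 (λ b k → ⊝ b ⊕ ⊝ (b ⊕ k ⊕ ⊝ b) ⊕ b ⊜ ⊝ k) refl b k ⟩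
            k ⁻¹                          ∎

          -- `t = b²` is inverted by `b` as an element of `Fixed`, yet commutes with `b`.
          t²≡ε : t ∙ t ≡ ε
          t²≡ε = begin
            t ∙ t                  ≡⟨ solve 1 (λ b → b ⊕ b ⊕ (b ⊕ b) ⊜ b ⊕ (b ⊕ b) ⊕ ⊝ b ⊕ (b ⊕ b)) refl b ⟩
            b ∙ t ∙ b ⁻¹ ∙ t       ≡⟨ cong (_∙ t) (b-inverts b²∈Fixed) ⟩
            t ⁻¹ ∙ t               ≡⟨ inverseˡ t ⟩
            ε                      ∎

          t∙ : ∀ {m} → m ∈ M → t ∙ m ≡ m ∙ t
          t∙ = K-central b²∈Fixed

          -- Compare φ (x y) with φ x φ y.
          commute-up-to-t : ∀ {x y} → x ∈ M → y ∈ M → x ∉ Fixed → y ∉ Fixed → x ∙ y ∉ Fixed →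
                            x ∙ y ≡ y ∙ x ∙ t
          commute-up-to-t {x} {y} x∈M y∈M x∉K y∉K xy∉K = begin
            x ∙ y
              ≡⟨ solve 3 (λ b x y → x ⊕ y ⊜ ⊝ b ⊕ ⊝ (⊝ b ⊕ ⊝ (b ⊕ (x ⊕ y))) ⊕ ⊝ b) refl b x y ⟩
            b ⁻¹ ∙ (b ⁻¹ ∙ (b ∙ (x ∙ y)) ⁻¹) ⁻¹ ∙ b ⁻¹
              ≡⟨ cong (λ u → b ⁻¹ ∙ u ⁻¹ ∙ b ⁻¹) (φ-off-Fixed (∙-∈ x∈M y∈M) xy∉K) ⟨
            b ⁻¹ ∙ φ (x ∙ y) ⁻¹ ∙ b ⁻¹
              ≡⟨ cong (λ u → b ⁻¹ ∙ u ⁻¹ ∙ b ⁻¹) (φ-∙ x y) ⟩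
            b ⁻¹ ∙ (φ x ∙ φ y) ⁻¹ ∙ b ⁻¹
              ≡⟨ cong₂ (λ u v → b ⁻¹ ∙ (u ∙ v) ⁻¹ ∙ b ⁻¹) (φ-off-Fixed x∈M x∉K) (φ-off-Fixed y∈M y∉K) ⟩
            b ⁻¹ ∙ (b ⁻¹ ∙ (b ∙ x) ⁻¹ ∙ (b ⁻¹ ∙ (b ∙ y) ⁻¹)) ⁻¹ ∙ b ⁻¹
              ≡⟨ solve 3 (λ b x y → ⊝ b ⊕ ⊝ (⊝ b ⊕ ⊝ (b ⊕ x) ⊕ (⊝ b ⊕ ⊝ (b ⊕ y))) ⊕ ⊝ b ⊜ y ⊕ (b ⊕ b ⊕ x)) refl b x y ⟩
            y ∙ (t ∙ x)
              ≡⟨ cong (y ∙_) (t∙ x∈M) ⟩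
            y ∙ (x ∙ t)
              ≡⟨ assoc y x t ⟨
            y ∙ x ∙ t ∎

          -- `x y` is central, so it commutes with `x`; cancel `x`.
          ∙-∈⇒commute : ∀ {x y} → x ∈ M → y ∈ M → x ∙ y ∈ Fixed → x ∙ y ≡ y ∙ x
          ∙-∈⇒commute {x} {y} x∈M y∈M xy∈K = ∙-cancelˡ x _ _
            (trans (sym (K-central xy∈K x∈M)) (assoc x y x))

          -- `t` is the only possible obstruction to commuting in `M`, which is nonabelian.
          t≢ε : t ≢ ε
          t≢ε t≡ε = nonabelian abelian
            where
            abelian : IsAbelianSub G M
            abelian x y x∈M y∈M with x ∈? Fixed | y ∈? Fixed | x ∙ y ∈? Fixed
            ... | yes x∈K | _       | _        = K-central x∈K y∈M
            ... | no _    | yes y∈K | _        = sym (K-central y∈K x∈M)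
            ... | no _    | no _    | yes xy∈K = ∙-∈⇒commute x∈M y∈M xy∈K
            ... | no x∉K  | no y∉K  | no xy∉K  =
              trans (commute-up-to-t x∈M y∈M x∉K y∉K xy∉K) (trans (cong (y ∙ x ∙_) t≡ε) (identityʳ _))

          commute⇒∙-∈ : ∀ {x y} → x ∈ M → y ∈ M → x ∉ Fixed → y ∉ Fixed → x ∙ y ≡ y ∙ x → x ∙ y ∈ Fixed
          commute⇒∙-∈ {x} {y} x∈M y∈M x∉K y∉K xy≡yx = decidable-stable (x ∙ y ∈? Fixed) λ xy∉K →
            t≢ε (identityʳ-unique (y ∙ x) t (trans (sym (commute-up-to-t x∈M y∈M x∉K y∉K xy∉K)) xy≡yx))
            where open GroupProperties group using (identityʳ-unique)

          Fixed⊆Centre : Fixed ⊆ Centre G M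
          Fixed⊆Centre k∈K = Centre⁺ (Fixed⊆M k∈K) (K-central k∈K)

          -- A central `x` off `Fixed` commutes with `m₁` and with `m₁ m₂`, so `x m₁` and `x m₁ m₂`
          -- are both in `Fixed`; their quotient `m₂` is not.
          Centre⊆Fixed : Centre G M ⊆ Fixed
          Centre⊆Fixed {x} x∈Z = decidable-stable (x ∈? Fixed) λ x∉K →
            m₂∉K (K.∙-cancelˡ-∈ (commute⇒∙-∈ x∈M m₁∈M x∉K m₁∉K (Centre-central x∈Z m₁∈M))
              (subst (_∈ Fixed) (sym (assoc x m₁ m₂))
                (commute⇒∙-∈ x∈M m₁m₂∈M x∉K m₁m₂∉K (Centre-central x∈Z m₁m₂∈M))))
            where x∈M = Centre⊆ x∈Z

          Fixed≡Centre : Fixed ≡ Centre G M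
          Fixed≡Centre = ⊆-antisym Fixed⊆Centre Centre⊆Fixed

          -- Commuting up to t with both m₁ and m₂ means commuting with m₁ m₂, as t is central and t² = 1.
          |M:Fixed|≡4 : Index G M Fixed 4
          |M:Fixed|≡4 = ℕ.≤-antisym (cosets-cover⇒≤ rs cover)
            (distinct-cosets⇒≤ M≤ Fixed-isSubgroup Fixed⊆M rs (ε-∈ ∷ m₁∈M ∷ m₂∈M ∷ m₁m₂∈M ∷ [])
              ( (m₁∉K ∘ ε⁻¹∙ ∷ m₂∉K ∘ ε⁻¹∙ ∷ m₁m₂∉K ∘ ε⁻¹∙ ∷ [])
              -- `m₁` commutes with itself, so its square is in `Fixed`.
              ∷ ( (λ ∈K → m₁m₂∉K (subst (_∈ Fixed) (solve 2 (λ x y → x ⊕ x ⊕ (⊝ x ⊕ y) ⊜ x ⊕ y) refl m₁ m₂)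
                    (K.∙-∈ (commute⇒∙-∈ m₁∈M m₁∈M m₁∉K m₁∉K refl) ∈K)))
                ∷ m₂∉K ∘ subst (_∈ Fixed) (solve 2 (λ x y → ⊝ x ⊕ (x ⊕ y) ⊜ y) refl m₁ m₂) ∷ [])
              -- If `m₂⁻¹ m₁ m₂` is in `Fixed`, it is central, hence equal to `m₁`.
              ∷ ( (λ ∈K → m₁∉K (subst (_∈ Fixed)
                    (∙-cancelʳ m₂ _ _ (trans (K-central ∈K m₂∈M)
                      (solve 2 (λ x y → y ⊕ (⊝ y ⊕ (x ⊕ y)) ⊜ x ⊕ y) refl m₁ m₂))) ∈K)) ∷ [])
              ∷ [] ∷ []))
            where
            rs = ε ∷ m₁ ∷ m₂ ∷ m₁ ∙ m₂ ∷ []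

            ε⁻¹∙ : ∀ {u} → ε ⁻¹ ∙ u ∈ Fixed → u ∈ Fixed
            ε⁻¹∙ {u} = subst (_∈ Fixed) (solve 1 (λ u → ⊝ id ⊕ u ⊜ u) refl u)

            cover : ∀ {h} → h ∈ M → Any (λ r → r ∙ h ∈ Fixed) rs
            cover {h} h∈M with h ∈? Fixed | m₁ ∙ h ∈? Fixed | m₂ ∙ h ∈? Fixed
            ... | yes h∈K | _         | _         = here (subst (_∈ Fixed) (sym (identityˡ h)) h∈K)
            ... | no _    | yes m₁h∈K | _         = there (here m₁h∈K)
            ... | no _    | no _      | yes m₂h∈K = there (there (here m₂h∈K))
            ... | no h∉K  | no m₁h∉K  | no m₂h∉K  = there (there (there (here
              (commute⇒∙-∈ m₁m₂∈M h∈M m₁m₂∉K h∉K (begin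
                m₁ ∙ m₂ ∙ h            ≡⟨ assoc m₁ m₂ h ⟩
                m₁ ∙ (m₂ ∙ h)          ≡⟨ cong (m₁ ∙_) (commute-up-to-t m₂∈M h∈M m₂∉K h∉K m₂h∉K) ⟩
                m₁ ∙ (h ∙ m₂ ∙ t)      ≡⟨ solve 4 (λ x y h t → x ⊕ (h ⊕ y ⊕ t) ⊜ x ⊕ h ⊕ (y ⊕ t)) refl m₁ m₂ h t ⟩
                m₁ ∙ h ∙ (m₂ ∙ t)
                  ≡⟨ cong₂ _∙_ (commute-up-to-t m₁∈M h∈M m₁∉K h∉K m₁h∉K) (sym (t∙ m₂∈M)) ⟩
                h ∙ m₁ ∙ t ∙ (t ∙ m₂)
                  ≡⟨ solve 4 (λ x y h t → h ⊕ x ⊕ t ⊕ (t ⊕ y) ⊜ h ⊕ x ⊕ (t ⊕ t) ⊕ y) refl m₁ m₂ h t ⟩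
                h ∙ m₁ ∙ (t ∙ t) ∙ m₂  ≡⟨ cong (λ u → h ∙ m₁ ∙ u ∙ m₂) t²≡ε ⟩
                h ∙ m₁ ∙ ε ∙ m₂        ≡⟨ solve 3 (λ x y h → h ⊕ x ⊕ id ⊕ y ⊜ h ⊕ (x ⊕ y)) refl m₁ m₂ h ⟩
                h ∙ (m₁ ∙ m₂)          ∎)))))

          commute⇒comm≡ε : ∀ {x y} → x ∙ y ≡ y ∙ x → comm G x y ≡ ε
          commute⇒comm≡ε {x} {y} xy≡yx = begin
            x ⁻¹ ∙ y ⁻¹ ∙ x ∙ y   ≡⟨ solve 2 (λ x y → ⊝ x ⊕ ⊝ y ⊕ x ⊕ y ⊜ ⊝ x ⊕ ⊝ y ⊕ (x ⊕ y)) refl x y ⟩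
            x ⁻¹ ∙ y ⁻¹ ∙ (x ∙ y) ≡⟨ cong (x ⁻¹ ∙ y ⁻¹ ∙_) xy≡yx ⟩
            x ⁻¹ ∙ y ⁻¹ ∙ (y ∙ x) ≡⟨ solve 2 (λ x y → ⊝ x ⊕ ⊝ y ⊕ (y ⊕ x) ⊜ id) refl x y ⟩
            ε                     ∎

          comm≡t : ∀ {x y} → x ∈ M → y ∈ M → x ∉ Fixed → y ∉ Fixed → x ∙ y ∉ Fixed → comm G x y ≡ t
          comm≡t {x} {y} x∈M y∈M x∉K y∉K xy∉K = begin
            x ⁻¹ ∙ y ⁻¹ ∙ x ∙ y       ≡⟨ solve 2 (λ x y → ⊝ x ⊕ ⊝ y ⊕ x ⊕ y ⊜ ⊝ x ⊕ ⊝ y ⊕ (x ⊕ y)) refl x y ⟩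
            x ⁻¹ ∙ y ⁻¹ ∙ (x ∙ y)     ≡⟨ cong (x ⁻¹ ∙ y ⁻¹ ∙_) (commute-up-to-t x∈M y∈M x∉K y∉K xy∉K) ⟩
            x ⁻¹ ∙ y ⁻¹ ∙ (y ∙ x ∙ t) ≡⟨ solve 3 (λ x y t → ⊝ x ⊕ ⊝ y ⊕ (y ⊕ x ⊕ t) ⊜ t) refl x y t ⟩
            t                         ∎

          commutators⊆⟨t⟩ : ∀ {g} → InGen G (Commutators G M) g → InGen G (_≡ t) g
          commutators⊆⟨t⟩ one       = one
          commutators⊆⟨t⟩ (mul p q) = mul (commutators⊆⟨t⟩ p) (commutators⊆⟨t⟩ q)
          commutators⊆⟨t⟩ (inv p)   = inv (commutators⊆⟨t⟩ p)
          commutators⊆⟨t⟩ (gen (x , y , x∈M , y∈M , refl))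
            with x ∈? Fixed | y ∈? Fixed | x ∙ y ∈? Fixed
          ... | yes x∈K | _       | _        = subst (InGen G _) (sym (commute⇒comm≡ε (K-central x∈K y∈M))) one
          ... | no _    | yes y∈K | _        = subst (InGen G _) (sym (commute⇒comm≡ε (sym (K-central y∈K x∈M)))) one
          ... | no _    | no _    | yes xy∈K = subst (InGen G _) (sym (commute⇒comm≡ε (∙-∈⇒commute x∈M y∈M xy∈K))) one
          ... | no x∉K  | no y∉K  | no xy∉K  = gen (comm≡t x∈M y∈M x∉K y∉K xy∉K)

          ⟨t⟩⊆commutators : ∀ {g} → InGen G (_≡ t) g → InGen G (Commutators G M) g
          ⟨t⟩⊆commutators (gen g≡t) =
            gen (m₁ , m₂ , m₁∈M , m₂∈M , trans g≡t (sym (comm≡t m₁∈M m₂∈M m₁∉K m₂∉K m₁m₂∉K)))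
          ⟨t⟩⊆commutators one       = one
          ⟨t⟩⊆commutators (mul p q) = mul (⟨t⟩⊆commutators p) (⟨t⟩⊆commutators q)
          ⟨t⟩⊆commutators (inv p)   = inv (⟨t⟩⊆commutators p)

          |b|≡4 : HasOrder G b 4
          |b|≡4 = s≤s z≤n
            , trans (solve 1 (λ b → id ⊕ b ⊕ b ⊕ b ⊕ b ⊜ b ⊕ b ⊕ (b ⊕ b)) refl b) t²≡ε
            , λ { (suc zero) _ _ b≡ε → t≢ε (begin
                    b ∙ b          ≡⟨ solve 1 (λ b → b ⊕ b ⊜ (id ⊕ b) ⊕ (id ⊕ b)) refl b ⟩
                    ε ∙ b ∙ (ε ∙ b) ≡⟨ cong₂ _∙_ b≡ε b≡ε ⟩
                    ε ∙ ε          ≡⟨ identityˡ ε ⟩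
                    ε              ∎)
                ; (suc (suc zero)) _ _ b²≡ε → t≢ε (trans (cong (_∙ b) (sym (identityˡ b))) b²≡ε)
                ; (suc (suc (suc zero))) _ _ b³≡ε → t≢ε (begin
                    b ∙ b                        ≡⟨ solve 1 (λ b → let c = id ⊕ b ⊕ b ⊕ b in b ⊕ b ⊜ c ⊕ c ⊕ ⊝ (b ⊕ b ⊕ (b ⊕ b))) refl b ⟩
                    pow G b 3 ∙ pow G b 3 ∙ (t ∙ t) ⁻¹ ≡⟨ cong₂ (λ u v → u ∙ u ∙ v ⁻¹) b³≡ε t²≡ε ⟩
                    ε ∙ ε ∙ ε ⁻¹                 ≡⟨ solve 0 (id ⊕ id ⊕ ⊝ id ⊜ id) refl ⟩
                    ε                            ∎)
                ; (suc (suc (suc (suc _)))) _ (s≤s (s≤s (s≤s (s≤s ())))) _ }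

          index-four⇒cond3 : Cond3 G M
          index-four⇒cond3 = subst (λ Z → Index G M Z 4) Fixed≡Centre |M:Fixed|≡4
            , b , b∉M , (λ g → mk⇔ commutators⊆⟨t⟩ ⟨t⟩⊆commutators) , |b|≡4
            , (λ z z∈Z → conj-inverts (Centre⊆Fixed z∈Z))
            , m₁ , m₁∈M , (m₁∉K ∘ Centre⊆Fixed)
            , λ (_ , bm≡ε , _) → bm-nonInvolution m₁∈M m₁∉K (trans (cong (_∙ (b ∙ m₁)) (sym (identityˡ _))) bm≡ε)

  twist⇒conditions : HasTwist → Cond1 G M ⊎ Cond2 G M ⊎ Cond3 G M
  twist⇒conditions (φ , (φ-∙ , _) , (g , φg≢g) , fi) = split abelian?
    where
    abelian? : Dec (IsAbelianSub G M)
    abelian? = all? λ x → all? λ y → (x ∈? M) →-dec ((y ∈? M) →-dec (x ∙ y ≟ y ∙ x))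

    K = Fixed φ-∙ fi

    fixed-outside : ¬ IsAbelianSub G M → ∃[ b ] (b ∉ M × φ b ≡ b)
    fixed-outside nonabelian with any? (λ b → ¬? (b ∈? M) ×-dec (φ b ≟ b))
    ... | yes found = found
    ... | no  none  = contradiction (inverts-outside⇒abelian φ-∙ fi inverts) nonabelian
      where
      inverts : ∀ g → g ∉ M → φ g ≡ g ⁻¹
      inverts g g∉M with fi g g∉M
      ... | inj₁ fixes   = contradiction (g , g∉M , fixes) none
      ... | inj₂ inverts = inverts

    -- A moved element outside `M` is carried into `M` by the fixed `b⁻¹` and stays moved.
    moved-inside : ∀ {b} → b ∉ M → φ b ≡ b → ∃[ m ] (m ∈ M × m ∉ K)
    moved-inside {b} b∉M φb≡b with g ∈? M
    ... | yes g∈M = g , g∈M , φg≢g ∘ Fixed-fixed φ-∙ fi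
    ... | no  g∉M = b ⁻¹ ∙ g , outside-∙-outside (outside-⁻¹ b∉M) g∉M , λ ∈K → φg≢g (begin
      φ g                    ≡⟨ cong φ (solve 2 (λ b g → g ⊜ b ⊕ (⊝ b ⊕ g)) refl b g) ⟩
      φ (b ∙ (b ⁻¹ ∙ g))     ≡⟨ φ-∙ _ _ ⟩
      φ b ∙ φ (b ⁻¹ ∙ g)     ≡⟨ cong₂ _∙_ φb≡b (Fixed-fixed φ-∙ fi ∈K) ⟩
      b ∙ (b ⁻¹ ∙ g)         ≡⟨ solve 2 (λ b g → b ⊕ (⊝ b ⊕ g) ⊜ g) refl b g ⟩
      g                      ∎)

    split : Dec (IsAbelianSub G M) → Cond1 G M ⊎ Cond2 G M ⊎ Cond3 G M
    split (yes abelian) = inj₁ (abelian , λ dihedral → φg≢g (dihedral⇒fixes φ-∙ fi dihedral g))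
    split (no nonabelian) with fixed-outside nonabelian
    ... | b , b∉M , φb≡b with moved-inside b∉M φb≡b
    -- A successful search leads to (3); a failed one says that `m₁` multiplies everything in `M`
    -- off `K` into `K`, which is index two and leads to (2).
    ... | m₁ , m₁∈M , m₁∉K with any? (λ x → (x ∈? M) ×-dec (¬? (x ∈? K) ×-dec ¬? (m₁ ∙ x ∈? K)))
    ... | yes (m₂ , m₂∈M , m₂∉K , m₁m₂∉K) =
      inj₂ (inj₂ (index-four⇒cond3 m₁∈M m₁∉K m₂∈M m₂∉K m₁m₂∉K nonabelian))
      where open FixedOutside φ-∙ fi b∉M φb≡b
    ... | no none =
      inj₂ (inj₁ (index-two⇒cond2 m₁∈M m₁∉K λ {x} x∈M x∉K → decidable-stable (m₁ ∙ x ∈? K)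
        (λ m₁x∉K → none (x , x∈M , x∉K , m₁x∉K))))
      where open FixedOutside φ-∙ fi b∉M φb≡b

theorem1p1 : (R : FinGroup) (M : Subset (FinGroup.n R)) →
    IsSubgroup R M → Index R ⊤ M 2 →
    (∃[ φ ] (IsAutomorphism R φ × (∃[ g ] φ g ≢ g) ×
        (∀ g → g ∉ M → (φ g ≡ g) ⊎ (φ g ≡ FinGroup._⁻¹ R g))))
    ⇔ (Cond1 R M ⊎ Cond2 R M ⊎ Cond3 R M)
theorem1p1 R M M≤ |R:M|≡2 = mk⇔ (Necessity.twist⇒conditions R M≤ |R:M|≡2)
  [ IndexTwo.abelian-nonDihedral⇒twist R M≤ |R:M|≡2
  , [ centralInvolution⇒twist
    , (λ (|M:Z|≡4 , a , a∉M , γ₂M≡⟨a²⟩ , |a|≡4 , inverted , m) →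
        invertedCentre⇒twist a∉M γ₂M≡⟨a²⟩ |a|≡4 |M:Z|≡4 inverted m) ] ]
  where open Sufficiency R M≤ |R:M|≡2
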